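{- Fix positive integers $m,n$. Call a pair $\big((a_i,b_i)_{i\in\mathbb N},\mathcal U\big)$ \emph{admissible} if $\mathcal U$ is a non-principal ultrafilter on $\mathbb N$ and $(a_i,b_i)_{i\in\mathbb N}$ is a sequence of pairs of natural numbers such that: $2\le a_i<b_i$ and $\gcd(a_i,b_i)=1$ for all $i$; $m b_i\equiv n \pmod{a_i}$ for all $i$; $\gcd(m,a_i)=1$ for all but finitely many $i$; $\lim_{i\to\infty}a_i=\infty$; and for every prime $p$ there is some $e\in\mathbb N$ such that $\{i : p^e \mid a_i\}$ is finite. For an admissible pair let $S_i=\{ua_i+vb_i : u,v\in\mathbb N\}$ and let $S=\prod_{i}S_i/\mathcal U$, viewed as a structure in the language $\{+,<,0\}$ of ordered monoids. Associate to an admissible pair the following data: (D1) for every $k\ge 1$ and $0\le r<k$, whether $\{i : a_i\equiv r \pmod k\}\in\mathcal U$; (D2) the real number $q_0=\sup\{p/q : p,q\in\mathbb N,\ q\ge 1,\ \{i : p\,b_i\le q\,a_i\}\in\mathcal U\}$; (D3) for every $k\ge1$ and $0\le r<k$, whether $\{i : \lfloor b_i/a_i\rfloor\equiv r \pmod k\}\in\mathcal U$. Then the complete first-order theory of $S$ is determined by these data: if two admissible pairs (for the same $m,n$) yield ultraproducts $S$ and $S'$ which have the same data (D1) and the same value of $q_0$ in (D2), and, in case $q_0=0$, also the same data (D3), then $S$ and $S'$ are elementarily equivalent in the language $\{+,<,0\}$.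
   Context: A (standard) 2-semigroup generated by coprime $a<b$ is the submonoid $\{ua+vb: u,v\in\mathbb N\}$ of $(\mathbb N,+,<,0)$. The ultraproduct $\prod_i S_i/\mathcal U$ is the usual model-theoretic ultraproduct of the ordered monoids $(S_i,+,<,0)$. The datum (D2) is the paper's ratio $r(a,b)$ of the ultraproduct generators $a=[(a_i)]_{\mathcal U}$, $b=[(b_i)]_{\mathcal U}$; the datum (D3) is the list of residues modulo every $k$ of the multiple $\alpha(b)=a\lfloor b/a\rfloor$ measured in multiples of $a$ (the "$M_a$-residues of $\alpha(b)$"); the condition $mb_i\equiv n\pmod{a_i}$ with $m<a_i$ expresses that $m\cdot b$ equals the least multiple of $b$ exceeding a multiple of $a$ by exactly $n$. -}

module Defs where

open import Data.Nat using (ℕ; zero; suc; _+_; _*_; _^_; _≤_; _<_; _/_; _%_)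
open import Data.Nat.GCD using (gcd)
open import Data.Nat.Primality using (Prime)
open import Data.Nat.Divisibility using (_∣_)
open import Data.Integer as ℤ using (ℤ; +_)
import Data.Integer.Divisibility as ℤD
open import Data.Fin using (Fin; zero; suc)
open import Data.Vec using (Vec; []; _∷_; lookup)
open import Data.Product using (Σ; ∃; ∃-syntax; _×_; _,_; proj₁)
open import Data.Sum using (_⊎_)
open import Data.Unit using (⊤)
open import Data.Empty using (⊥)
open import Relation.Nullary using (¬_)
open import Relation.Binary.PropositionalEquality using (_≡_)
open import Function.Bundles using (_⇔_)

Subset : Set₁
Subset = ℕ → Set

record Ultrafilter : Set₁ where
  field
    _∈U        : Subset → Set
    whole      : (λ _ → ⊤) ∈U
    proper     : ¬ ((λ _ → ⊥) ∈U)
    upward     : (A B : Subset) → (∀ i → A i → B i) → A ∈U → B ∈U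
    intersect  : (A B : Subset) → A ∈U → B ∈U → (λ i → A i × B i) ∈U
    ultra      : (A : Subset) → (A ∈U) ⊎ ((λ i → ¬ A i) ∈U)

open Ultrafilter public

-- non-principal: contains no finite set; equivalently (for an
-- ultrafilter) it contains every cofinite set {i : N ≤ i}
NonPrincipal : Ultrafilter → Set
NonPrincipal U = (N : ℕ) → _∈U U (λ i → N ≤ i)

-- a ≡ b (mod k) over the integers (so no subtraction issues)
_≡_[mod_] : ℕ → ℕ → ℕ → Set
x ≡ y [mod k ] = (+ k) ℤD.∣ ((+ x) ℤ.- (+ y))

Finite : Subset → Set
Finite A = ∃[ N ] (∀ i → A i → i < N)

-- floor division; a = 0 never occurs for admissible data (a_i ≥ 2)
⌊_/_⌋ : ℕ → ℕ → ℕ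
⌊ b / zero ⌋ = 0
⌊ b / suc a ⌋ = b / suc a

record Admissible (m n : ℕ) (a b : ℕ → ℕ) (U : Ultrafilter) : Set₁ where
  field
    nonPrincipal : NonPrincipal U
    two≤a        : ∀ i → 2 ≤ a i
    a<b          : ∀ i → a i < b i
    coprime      : ∀ i → gcd (a i) (b i) ≡ 1
    congr        : ∀ i → (m * b i) ≡ n [mod a i ]
    gcd-m-a      : Finite (λ i → ¬ (gcd m (a i) ≡ 1))
    a→∞          : ∀ M → ∃[ N ] (∀ i → N ≤ i → M ≤ a i)
    primePowers  : ∀ p → Prime p → ∃[ e ] Finite (λ i → (p ^ e) ∣ a i)

InS : ℕ → ℕ → ℕ → Set
InS a b x = ∃[ u ] ∃[ v ] (x ≡ u * a + v * b)

record Structure : Set₁ where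
  field
    Carrier : Set
    _≈_     : Carrier → Carrier → Set
    _⊕_     : Carrier → Carrier → Carrier
    _≺_     : Carrier → Carrier → Set
    𝟘       : Carrier

Ultraproduct : (a b : ℕ → ℕ) → Ultrafilter → Structure
Ultraproduct a b U = record
  { Carrier = Σ (ℕ → ℕ) (λ x → ∀ i → InS (a i) (b i) (x i))
  ; _≈_ = λ x y → _∈U U (λ i → proj₁ x i ≡ proj₁ y i)
  ; _⊕_ = λ x y → (λ i → proj₁ x i + proj₁ y i) , sum-in x y
  ; _≺_ = λ x y → _∈U U (λ i → proj₁ x i < proj₁ y i)
  ; 𝟘 = (λ _ → 0) , (λ i → 0 , 0 , _≡_.refl)
  }
  where
  open import Data.Nat.Solver using (module +-*-Solver)
  open import Relation.Binary.PropositionalEquality using (cong₂; trans)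
  sum-in : (x y : Σ (ℕ → ℕ) (λ x → ∀ i → InS (a i) (b i) (x i))) →
           ∀ i → InS (a i) (b i) (proj₁ x i + proj₁ y i)
  sum-in (x , px) (y , py) i with px i | py i
  ... | u , v , e | u' , v' , e' =
    u + u' , v + v' , trans (cong₂ _+_ e e') (lemma u v u' v' (a i) (b i))
    where
    open +-*-Solver
    lemma : ∀ u v u' v' A B →
            (u * A + v * B) + (u' * A + v' * B) ≡ (u + u') * A + (v + v') * B
    lemma = solve 6 (λ u v u' v' A B →
              (u :* A :+ v :* B) :+ (u' :* A :+ v' :* B)
              := (u :+ u') :* A :+ (v :+ v') :* B) _≡_.refl

-- First-order logic in the language {+, <, 0}
-- (classical connectives: ¬, ∧, ∀ suffice; ∨, →, ∃ are abbreviations)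

data Term (k : ℕ) : Set where
  var  : Fin k → Term k
  zer  : Term k
  _+ₜ_ : Term k → Term k → Term k

data Formula (k : ℕ) : Set where
  _≐_  : Term k → Term k → Formula k
  _≺ₜ_ : Term k → Term k → Formula k
  ¬ᶠ_  : Formula k → Formula k
  _∧ᶠ_ : Formula k → Formula k → Formula k
  ∀ᶠ   : Formula (suc k) → Formula k

Sentence : Set
Sentence = Formula 0

module _ (M : Structure) where
  open Structure M

  evalT : ∀ {k} → Vec Carrier k → Term k → Carrier
  evalT ρ (var x)  = lookup ρ x
  evalT ρ zer      = 𝟘
  evalT ρ (s +ₜ t) = evalT ρ s ⊕ evalT ρ t

  -- Tarskian satisfaction, with atoms read classically (¬¬) so that the
  -- interpretation of every formula is ¬¬-stable (Gödel–Gentzen style).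
  Sat : ∀ {k} → Vec Carrier k → Formula k → Set
  Sat ρ (s ≐ t)  = ¬ ¬ (evalT ρ s ≈ evalT ρ t)
  Sat ρ (s ≺ₜ t) = ¬ ¬ (evalT ρ s ≺ evalT ρ t)
  Sat ρ (¬ᶠ φ)   = ¬ Sat ρ φ
  Sat ρ (φ ∧ᶠ ψ) = Sat ρ φ × Sat ρ ψ
  Sat ρ (∀ᶠ φ)   = (x : Carrier) → Sat (x ∷ ρ) φ

_⊨_ : Structure → Sentence → Set
M ⊨ φ = Sat M [] φ

ElementarilyEquivalent : Structure → Structure → Set
ElementarilyEquivalent M M' = (φ : Sentence) → (M ⊨ φ) ⇔ (M' ⊨ φ)

SameD1 : (a : ℕ → ℕ) → Ultrafilter → (a' : ℕ → ℕ) → Ultrafilter → Set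
SameD1 a U a' U' = ∀ k r → r < suc k →
  _∈U U (λ i → a i % suc k ≡ r) ⇔ _∈U U' (λ i → a' i % suc k ≡ r)

-- C = { p/q : q ≥ 1, {i : p b_i ≤ q a_i} ∈ U },  q₀ = sup C.
-- BelowQ0 a b U p q  ⟺  p/q < q₀  (for q ≥ 1).
BelowQ0 : (a b : ℕ → ℕ) → Ultrafilter → ℕ → ℕ → Set
BelowQ0 a b U p q = ∃[ p' ] ∃[ q' ] (1 ≤ q' × p * q' < p' * q ×
                      _∈U U (λ i → p' * b i ≤ q' * a i))

-- two reals are equal iff the same rationals lie strictly below them
SameQ0 : (a b : ℕ → ℕ) → Ultrafilter → (a' b' : ℕ → ℕ) → Ultrafilter → Set
SameQ0 a b U a' b' U' = ∀ p q → 1 ≤ q → BelowQ0 a b U p q ⇔ BelowQ0 a' b' U' p q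

-- q₀ = 0  ⟺  0/1 is not below q₀
Q0IsZero : (a b : ℕ → ℕ) → Ultrafilter → Set
Q0IsZero a b U = ¬ BelowQ0 a b U 0 1

SameD3 : (a b : ℕ → ℕ) → Ultrafilter → (a' b' : ℕ → ℕ) → Ultrafilter → Set
SameD3 a b U a' b' U' = ∀ k r → r < suc k →
  _∈U U (λ i → ⌊ b i / a i ⌋ % suc k ≡ r) ⇔ _∈U U' (λ i → ⌊ b' i / a' i ⌋ % suc k ≡ r)

{-# OPTIONS --safe #-}

-- Write m b = a C + n.  Every element of S is (p C + e) a + v b with e < C and v < a, and
--     m ((p C + e) a + v b) = a (C (m p + v) + m e) + n v.
-- The bounded parts n v and m e contribute only finitely many possible carries, so the sign of an
-- integer combination of elements of S is decided by linear inequalities in (a, p, v) together with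
-- linear inequalities in (C, e): no inequality mixes the two groups of variables.  Hence the
-- Ehrenfeucht–Fraïssé game on S and S' splits into two independent games on nonstandard models of
-- Presburger arithmetic, one with the constant a and one with the constant C, where the second
-- player only has to preserve signs of finitely many linear forms and residues modulo one number.
-- The position before the first move is described by the residues of the infinite number a, which
-- are (D1), and by C.  If q₀ > 0 then C is the standard number m / q₀; if q₀ = 0 then C is infinite
-- and C = m ⌊b/a⌋ + s with 0 ≤ s < m, where a s ≡ -n (mod m) determines s, so that (D1) and (D3)
-- give the residues of C.
--
-- Constructively, membership in an ultrafilter is decidable and weak excluded middle follows from
-- the existence of an ultrafilter; since satisfaction is ¬¬-stable, this is all the logic needed.

module Submission where

open import Defs
open import Data.Empty using (⊥; ⊥-elim)
open import Data.Fin using (Fin; zero; suc)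
open import Data.Integer using (ℤ; +_; -[1+_]; -_; _+_; _-_; _*_; 0ℤ; 1ℤ; -1ℤ; +≤+; ∣_∣)
import Data.Integer as ℤ
import Data.Integer.Coprimality as ℤC
open import Data.Integer.Divisibility.Signed using (_∣_; divides; _∣?_; ∣m∣n⇒∣m+n; ∣n⇒∣m*n; ∣-trans; ∣ᵤ⇒∣; ∣⇒∣ᵤ)
import Data.Integer.Properties as ℤP
open import Data.Integer.Tactic.RingSolver using (solve-∀)
open import Data.List using (List; []; _∷_; [_]; _++_; map; concatMap; upTo)
open import Data.List.Membership.Propositional using (_∈_)
open import Data.List.Membership.Propositional.Properties using (∈-map⁺; ∈-concatMap⁺; ∈-upTo⁺; ∈-++⁺ˡ; ∈-++⁺ʳ)
open import Data.List.Relation.Unary.All using (All; []; _∷_)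
import Data.List.Relation.Unary.All as All
import Data.List.Relation.Unary.All.Properties as AllP
open import Data.List.Relation.Unary.Any using (here; there)
import Data.List.Relation.Unary.Any as Any
open import Data.Nat using (ℕ; zero; suc; _≤_; _<_)
import Data.Nat as ℕ
import Data.Nat.Coprimality as ℕC
import Data.Nat.Divisibility as ℕD
open import Data.Nat.DivMod using (_/_; _%_; m≡m%n+[m/n]*n; m%n<n; m*n/n≡m)
open import Data.Nat.GCD using (gcd)
import Data.Nat.Properties as ℕP
import Data.Nat.Tactic.RingSolver as ℕSolver
open import Data.Product using (∃-syntax; Σ-syntax; _×_; _,_; proj₁; proj₂)
open import Data.Sum using (_⊎_; inj₁; inj₂)
open import Data.Unit using (⊤; tt)
open import Data.Vec using (Vec; []; _∷_; lookup)
open import Function.Bundles using (_⇔_; mk⇔; Equivalence)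
open import Function.Construct.Composition using (_⇔-∘_)
open import Function.Construct.Symmetry using (⇔-sym)
open import Relation.Binary.PropositionalEquality using (_≡_; refl; sym; trans; cong; cong₂; subst; subst₂)
open import Relation.Nullary using (¬_; Dec; yes; no)
open import Relation.Nullary.Decidable using (decidable-stable)

open Equivalence using (to; from)

-- Ultrafilters and nonnegative integers

module Almost (U : Ultrafilter) where

  Alm : Subset → Set
  Alm = _∈U U

  always : ∀ {A : Subset} → (∀ i → A i) → Alm A
  always f = upward U _ _ (λ i _ → f i) (whole U)

  map₁ : ∀ {A B : Subset} → (∀ i → A i → B i) → Alm A → Alm B
  map₁ = upward U _ _

  map₂ : ∀ {A B C : Subset} → (∀ i → A i → B i → C i) → Alm A → Alm B → Alm C
  map₂ f p q = map₁ (λ i (x , y) → f i x y) (intersect U _ _ p q)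

  map₃ : ∀ {A B C D : Subset} → (∀ i → A i → B i → C i → D i) → Alm A → Alm B → Alm C → Alm D
  map₃ f p q r = map₂ (λ i (x , y) → f i x y) (intersect U _ _ p q) r

  Alm⇒¬¬ : ∀ {P : Set} → Alm (λ _ → P) → ¬ ¬ P
  Alm⇒¬¬ p ¬p = proper U (map₁ (λ _ → ¬p) p)

  -- Largeness of a constant set only refutes the negation of its condition; decidability turns this
  -- into a proof. In this way facts about standard numbers come back from almost everywhere.
  Alm-dec : ∀ {P : Set} → Dec P → Alm (λ _ → P) → P
  Alm-dec (yes p) _ = p
  Alm-dec (no ¬p) q = ⊥-elim (Alm⇒¬¬ q ¬p)

  Alm-disjoint : ∀ {A B : Subset} → (∀ i → A i → B i → ⊥) → Alm A → ¬ Alm B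
  Alm-disjoint f p q = proper U (map₂ f p q)

  ¬Alm⇒Alm¬ : ∀ {A : Subset} → ¬ Alm A → Alm (λ i → ¬ A i)
  ¬Alm⇒Alm¬ {A} ¬p with ultra U A
  ... | inj₁ p = ⊥-elim (¬p p)
  ... | inj₂ q = q

  Alm? : ∀ (A : Subset) → Dec (Alm A)
  Alm? A with ultra U A
  ... | inj₁ p = yes p
  ... | inj₂ q = no (λ p → Alm-disjoint (λ i x ¬x → ¬x x) p q)

  weakLEM : ∀ (P : Set) → ¬ P ⊎ ¬ ¬ P
  weakLEM P with ultra U (λ _ → P)
  ... | inj₁ p = inj₂ (Alm⇒¬¬ p)
  ... | inj₂ q = inj₁ (λ p → Alm⇒¬¬ q (λ ¬p → ¬p p))

  -- Finitely many values partition a large set, and one of the pieces is large; the induction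
  -- splits off the largest value.
  bounded⇒constant : ∀ (f : ℕ → ℕ) B → Alm (λ i → f i < B) →
                     ∃[ r ] r < B × Alm (λ i → f i ≡ r)
  bounded⇒constant f zero    p = ⊥-elim (proper U (map₁ (λ i ()) p))
  bounded⇒constant f (suc B) p with ultra U (λ i → f i ≡ B)
  ... | inj₁ q = B , ℕP.≤-refl , q
  ... | inj₂ q with bounded⇒constant f B
                      (map₂ (λ i f<1+B f≢B → ℕP.≤∧≢⇒< (ℕP.≤-pred f<1+B) f≢B) p q)
  ...   | r , r<B , eq = r , ℕP.m<n⇒m<1+n r<B , eq

open Almost public

-- All inequalities take the form 0 ≤ z, so that deriving one from others means adding nonnegative
-- integers and rewriting by a ring identity.
NN : ℤ → Set
NN z = 0ℤ ℤ.≤ z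

NN-+ : ∀ {x y} → NN x → NN y → NN (x + y)
NN-+ (+≤+ _) (+≤+ _) = +≤+ ℕ.z≤n

NN-* : ∀ {x y} → NN x → NN y → NN (x * y)
NN-* {+ x} {+ y} _ _ = subst NN (ℤP.pos-* x y) (+≤+ ℕ.z≤n)

NN-ℕ : ∀ {x} → NN (+ x)
NN-ℕ = +≤+ ℕ.z≤n

NN-cancel : ∀ {d z} → 1 ≤ d → NN (+ d * z) → NN z
NN-cancel {suc d} {+ _} _ _ = NN-ℕ

-- Integers are discrete: z < 0 means z ≤ -1, so a negated inequality is again one of the same form.
¬NN⇒ : ∀ {z} → ¬ NN z → NN (-1ℤ - z)
¬NN⇒ {+ _}        ¬p = ⊥-elim (¬p NN-ℕ)
¬NN⇒ { -[1+ z ]} _  = NN-ℕ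

NN⇒¬ : ∀ {z} → NN (-1ℤ - z) → ¬ NN z
NN⇒¬ {+ suc _} ()
NN⇒¬ {+ zero} ()
NN⇒¬ { -[1+ z ]} _ ()

NN-∃ : ∀ {z} → NN z → ∃[ w ] z ≡ + w
NN-∃ {+ w} _ = w , refl

≤⇒NN : ∀ {x y} → x ≤ y → NN (+ y - + x)
≤⇒NN p = ℤP.i≤j⇒0≤j-i (+≤+ p)

NN⇒≤ : ∀ {x y} → NN (+ y - + x) → x ≤ y
NN⇒≤ p = ℤP.drop‿+≤+ (ℤP.0≤i-j⇒j≤i p)

<⇒NN : ∀ {x y} → x < y → NN (+ y - + x - 1ℤ)
<⇒NN {x} {y} p = subst NN (lem (+ y) (+ x)) (≤⇒NN p)
  where
  lem : ∀ a b → a - (1ℤ + b) ≡ a - b - 1ℤ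
  lem = solve-∀

NN⇒< : ∀ {x y} → NN (+ y - + x - 1ℤ) → x < y
NN⇒< {x} {y} p = NN⇒≤ (subst NN (lem (+ y) (+ x)) p)
  where
  lem : ∀ a b → a - b - 1ℤ ≡ a - (1ℤ + b)
  lem = solve-∀


NN--trans : ∀ x y z → NN (x - y) → NN (y - z) → NN (x - z)
NN--trans x y z p q = subst NN (lem x y z) (NN-+ p q)
  where
  lem : ∀ x y z → (x - y) + (y - z) ≡ x - z
  lem = solve-∀

¬NN--flip : ∀ x y → ¬ NN (x - y) → NN (y - x)
¬NN--flip x y ¬p = subst NN (lem x y) (NN-+ (¬NN⇒ ¬p) (NN-ℕ {1}))
  where
  lem : ∀ x y → (-1ℤ - (x - y)) + 1ℤ ≡ y - x
  lem = solve-∀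

-- Linear forms and agreement of environments

infixl 6 _⊞_ _⊟_
infixl 7 _⊡_

-- de Bruijn style: top is the most recent variable, wk t does not mention it.
data Lin : ℕ → Set where
  con : ∀ {k} → ℤ → Lin k
  top : ∀ {k} → Lin (suc k)
  wk  : ∀ {k} → Lin k → Lin (suc k)
  _⊞_ : ∀ {k} → Lin k → Lin k → Lin k
  _⊡_ : ∀ {k} → ℤ → Lin k → Lin k

_⊟_ : ∀ {k} → Lin k → Lin k → Lin k
s ⊟ t = s ⊞ (-1ℤ ⊡ t)

Env : ℕ → Set
Env k = Vec (ℕ → ℕ) k

⟦_⟧ : ∀ {k} → Lin k → Env k → ℕ → ℤ
⟦ con d ⟧ ρ       i = d
⟦ top   ⟧ (x ∷ ρ) i = + x i
⟦ wk t  ⟧ (x ∷ ρ) i = ⟦ t ⟧ ρ i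
⟦ s ⊞ t ⟧ ρ       i = ⟦ s ⟧ ρ i + ⟦ t ⟧ ρ i
⟦ c ⊡ t ⟧ ρ       i = c * ⟦ t ⟧ ρ i

coef : ∀ {k} → Lin (suc k) → ℤ
coef (con d) = 0ℤ
coef top     = 1ℤ
coef (wk t)  = 0ℤ
coef (s ⊞ t) = coef s + coef t
coef (c ⊡ t) = c * coef t

rest : ∀ {k} → Lin (suc k) → Lin k
rest (con d) = con d
rest top     = con 0ℤ
rest (wk t)  = t
rest (s ⊞ t) = rest s ⊞ rest t
rest (c ⊡ t) = c ⊡ rest t

⟦⟧-split : ∀ {k} (F : Lin (suc k)) x (ρ : Env k) i →
           ⟦ F ⟧ (x ∷ ρ) i ≡ coef F * + x i + ⟦ rest F ⟧ ρ i
⟦⟧-split (con d) x ρ i = lem (+ x i) d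
  where
  lem : ∀ x d → d ≡ 0ℤ * x + d
  lem = solve-∀
⟦⟧-split top x ρ i = lem (+ x i)
  where
  lem : ∀ x → x ≡ 1ℤ * x + 0ℤ
  lem = solve-∀
⟦⟧-split (wk t) x ρ i = lem (+ x i) (⟦ t ⟧ ρ i)
  where
  lem : ∀ x d → d ≡ 0ℤ * x + d
  lem = solve-∀
⟦⟧-split (s ⊞ t) x ρ i =
  trans (cong₂ _+_ (⟦⟧-split s x ρ i) (⟦⟧-split t x ρ i))
        (lem (coef s) (coef t) (+ x i) (⟦ rest s ⟧ ρ i) (⟦ rest t ⟧ ρ i))
  where
  lem : ∀ c d x s t → (c * x + s) + (d * x + t) ≡ (c + d) * x + (s + t)
  lem = solve-∀
⟦⟧-split (c ⊡ t) x ρ i =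
  trans (cong (c *_) (⟦⟧-split t x ρ i)) (lem c (coef t) (+ x i) (⟦ rest t ⟧ ρ i))
  where
  lem : ∀ c d x t → c * (d * x + t) ≡ (c * d) * x + c * t
  lem = solve-∀

-- Common residues and requirements

Congruent : ℕ → ℤ → ℤ → Set
Congruent M x y = + M ∣ (x - y)

-- The witness is one standard integer for both sides, not necessarily reduced modulo `M`, so that
-- linear forms can be evaluated on witnesses.
CommonResidue : Ultrafilter → Ultrafilter → ℕ → (ℕ → ℤ) → (ℕ → ℤ) → Set
CommonResidue U U' M f f' =
  ∃[ r ] Alm U (λ i → Congruent M (f i) r) × Alm U' (λ i → Congruent M (f' i) r)

SameResidues : Ultrafilter → Ultrafilter → ℕ → ∀ {k} → Env k → Env k → Set
SameResidues U U' M []      []        = ⊤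
SameResidues U U' M (x ∷ ρ) (x' ∷ ρ') =
  CommonResidue U U' M (λ i → + x i) (λ i → + x' i) × SameResidues U U' M ρ ρ'

Congruent-refl : ∀ M x → Congruent M x x
Congruent-refl M x = divides 0ℤ (lem x (+ M))
  where
  lem : ∀ x m → x - x ≡ 0ℤ * m
  lem = solve-∀

Congruent-+ : ∀ M x x' y y' → Congruent M x x' → Congruent M y y' → Congruent M (x + y) (x' + y')
Congruent-+ M x x' y y' c d = subst (+ M ∣_) (lem x x' y y') (∣m∣n⇒∣m+n c d)
  where
  lem : ∀ x x' y y' → (x - x') + (y - y') ≡ (x + y) - (x' + y')
  lem = solve-∀

Congruent-* : ∀ M c x x' → Congruent M x x' → Congruent M (c * x) (c * x')
Congruent-* M c x x' d = subst (+ M ∣_) (lem c x x') (∣n⇒∣m*n c d)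
  where
  lem : ∀ c x x' → c * (x - x') ≡ c * x - c * x'
  lem = solve-∀

Congruent-euclidean : ∀ M x y z → Congruent M x y → Congruent M x z → Congruent M y z
Congruent-euclidean M x y z c d = subst (+ M ∣_) (lem x y z) (∣m∣n⇒∣m+n (∣n⇒∣m*n -1ℤ c) d)
  where
  lem : ∀ x y z → -1ℤ * (x - y) + (x - z) ≡ y - z
  lem = solve-∀

SameResidues-⟦⟧ : ∀ {U U' M k} (F : Lin k) (ρ ρ' : Env k) → SameResidues U U' M ρ ρ' →
                  CommonResidue U U' M (⟦ F ⟧ ρ) (⟦ F ⟧ ρ')
SameResidues-⟦⟧ {U} {U'} {M} (con d) ρ ρ' _ =
  d , always U (λ _ → Congruent-refl M d) , always U' (λ _ → Congruent-refl M d)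
SameResidues-⟦⟧ top    (x ∷ ρ) (x' ∷ ρ') (c , _)  = c
SameResidues-⟦⟧ (wk t) (x ∷ ρ) (x' ∷ ρ') (_ , cs) = SameResidues-⟦⟧ t ρ ρ' cs
SameResidues-⟦⟧ {U} {U'} {M} (s ⊞ t) ρ ρ' cs
  with SameResidues-⟦⟧ s ρ ρ' cs | SameResidues-⟦⟧ t ρ ρ' cs
... | r , p , p' | q , o , o' =
  r + q , map₂ U  (λ i → Congruent-+ M (⟦ s ⟧ ρ  i) r (⟦ t ⟧ ρ  i) q) p o
        , map₂ U' (λ i → Congruent-+ M (⟦ s ⟧ ρ' i) r (⟦ t ⟧ ρ' i) q) p' o'
SameResidues-⟦⟧ {U} {U'} {M} (c ⊡ t) ρ ρ' cs with SameResidues-⟦⟧ t ρ ρ' cs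
... | r , p , p' =
  c * r , map₁ U  (λ i → Congruent-* M c (⟦ t ⟧ ρ  i) r) p
        , map₁ U' (λ i → Congruent-* M c (⟦ t ⟧ ρ' i) r) p'

SameSign : Ultrafilter → Ultrafilter → ∀ {k} → Env k → Env k → Lin k → Set
SameSign U U' ρ ρ' F = Alm U (λ i → NN (⟦ F ⟧ ρ i)) ⇔ Alm U' (λ i → NN (⟦ F ⟧ ρ' i))

record Requirement (k : ℕ) : Set where
  constructor req
  field
    forms   : List (Lin k)
    modulus : ℕ
    1≤modulus : 1 ≤ modulus

open Requirement public

record Agree (U U' : Ultrafilter) {k : ℕ} (Q : Requirement k) (ρ ρ' : Env k) : Set where
  constructor agree
  field
    signs    : ∀ {F} → F ∈ forms Q → SameSign U U' ρ ρ' F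
    residues : SameResidues U U' (modulus Q) ρ ρ'

open Agree public

SameResidues-sym : ∀ {U U' M k} (ρ ρ' : Env k) → SameResidues U U' M ρ ρ' → SameResidues U' U M ρ' ρ
SameResidues-sym []      []        _                   = tt
SameResidues-sym (x ∷ ρ) (x' ∷ ρ') ((r , p , p') , cs) = (r , p' , p) , SameResidues-sym ρ ρ' cs

Agree-sym : ∀ {U U' k} {Q : Requirement k} {ρ ρ'} → Agree U U' Q ρ ρ' → Agree U' U Q ρ' ρ
Agree-sym {ρ = ρ} {ρ'} (agree s r) =
  agree (λ F∈ → mk⇔ (from (s F∈)) (to (s F∈))) (SameResidues-sym ρ ρ' r)

SameResidues-∣ : ∀ {U U' M N k} (ρ ρ' : Env k) → (+ M) ∣ (+ N) →
                 SameResidues U U' N ρ ρ' → SameResidues U U' M ρ ρ'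
SameResidues-∣ []      []        d _ = tt
SameResidues-∣ {U} {U'} (x ∷ ρ) (x' ∷ ρ') d ((r , p , p') , cs) =
  (r , map₁ U (λ _ → ∣-trans d) p , map₁ U' (λ _ → ∣-trans d) p') , SameResidues-∣ ρ ρ' d cs

infixr 5 _∪_

-- Residues modulo a product determine the residues modulo both factors, so one modulus serves both
-- requirements.
_∪_ : ∀ {k} → Requirement k → Requirement k → Requirement k
req Φ M p ∪ req Ψ N q = req (Φ ++ Ψ) (M ℕ.* N) (ℕP.*-mono-≤ p q)

Agree-∪ˡ : ∀ {U U' k} {Q R : Requirement k} {ρ ρ'} → Agree U U' (Q ∪ R) ρ ρ' → Agree U U' Q ρ ρ'
Agree-∪ˡ {Q = Q} {R} {ρ} {ρ'} (agree s r) =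
  agree (λ F∈ → s (∈-++⁺ˡ F∈))
        (SameResidues-∣ ρ ρ'
          (divides (+ modulus R)
            (trans (ℤP.pos-* (modulus Q) (modulus R)) (ℤP.*-comm (+ modulus Q) (+ modulus R)))) r)

Agree-∪ʳ : ∀ {U U' k} {Q R : Requirement k} {ρ ρ'} → Agree U U' (Q ∪ R) ρ ρ' → Agree U U' R ρ ρ'
Agree-∪ʳ {Q = Q} {R} {ρ} {ρ'} (agree s r) =
  agree (λ F∈ → s (∈-++⁺ʳ (forms Q) F∈))
        (SameResidues-∣ ρ ρ' (divides (+ modulus Q) (ℤP.pos-* (modulus Q) (modulus R))) r)

-- Total, with a dummy value at `d` = 0, so that it can be applied at every index although the
-- divisor is positive only almost everywhere.
euclid : ∀ x d → ∃[ q ] ∃[ r ] (1 ≤ d → x ≡ q ℕ.* d ℕ.+ r × r < d)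
euclid x zero    = 0 , 0 , λ ()
euclid x (suc d) = x / suc d , x % suc d , λ _ →
  trans (m≡m%n+[m/n]*n x (suc d)) (ℕP.+-comm (x % suc d) _) , m%n<n x (suc d)

constantResidue : ∀ U (f : ℕ → ℤ) M → 1 ≤ M → Alm U (λ i → NN (f i)) →
                  ∃[ r ] r < M × Alm U (λ i → ∃[ q ] f i ≡ + q * + M + + r)
constantResidue U f M 1≤M p
  with bounded⇒constant U (λ i → proj₁ (proj₂ (euclid ∣ f i ∣ M))) M
         (always U (λ i → proj₂ (proj₂ (proj₂ (euclid ∣ f i ∣ M)) 1≤M)))
... | r , r<M , eq = r , r<M , map₂ U split p eq
  where
  split : ∀ i → NN (f i) → proj₁ (proj₂ (euclid ∣ f i ∣ M)) ≡ r → ∃[ q ] f i ≡ + q * + M + + r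
  split i nn refl with euclid ∣ f i ∣ M
  ... | q , s , h = q , trans (sym (ℤP.0≤i⇒+∣i∣≡i nn))
          (trans (cong +_ (proj₁ (h 1≤M))) (cong (_+ + s) (ℤP.pos-* q M)))

euclid-* : ∀ w d → 1 ≤ d → proj₁ (euclid (w ℕ.* d) d) ≡ w
euclid-* w (suc d) _ = m*n/n≡m w (suc d)

-- One move of the game on Presburger arithmetic

∈-concatMap : ∀ {A B : Set} (f : A → List B) {x y xs} → x ∈ xs → y ∈ f x → y ∈ concatMap f xs
∈-concatMap f x∈ y∈ = ∈-concatMap⁺ f (Any.map (λ { refl → y∈ }) x∈)

-- The ultrafilter orders the forms linearly, so a running maximum works. `T₀` is the current
-- candidate and is known to lie below `y`; forms above `y` are passed over.
greatest : ∀ U {k} (ρ : Env k) (y : ℕ → ℤ) T₀ Ts → Alm U (λ i → NN (y i - ⟦ T₀ ⟧ ρ i)) →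
  ∃[ S ] S ∈ T₀ ∷ Ts × Alm U (λ i → NN (y i - ⟦ S ⟧ ρ i)) ×
  (∀ {T} → T ∈ T₀ ∷ Ts → Alm U (λ i → NN (y i - ⟦ T ⟧ ρ i)) →
           Alm U (λ i → NN (⟦ S ⟧ ρ i - ⟦ T ⟧ ρ i)))
greatest U ρ y T₀ [] p =
  T₀ , here refl , p , λ { (here refl) _ → always U (λ i → ℤP.i≤j⇒0≤j-i (ℤP.≤-refl {⟦ T₀ ⟧ ρ i})) }
greatest U ρ y T₀ (T₁ ∷ Ts) p with Alm? U (λ i → NN (y i - ⟦ T₁ ⟧ ρ i))
greatest U ρ y T₀ (T₁ ∷ Ts) p | no ¬q with greatest U ρ y T₀ Ts p
... | S , S∈ , S≤y , max = S , weaken S∈ , S≤y , λ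
  { (here refl)         t → max (here refl) t
  ; (there (here refl)) t → ⊥-elim (¬q t)
  ; (there (there T∈))  t → max (there T∈) t }
  where
  weaken : ∀ {S} → S ∈ T₀ ∷ Ts → S ∈ T₀ ∷ T₁ ∷ Ts
  weaken (here e)  = here e
  weaken (there e) = there (there e)
greatest U ρ y T₀ (T₁ ∷ Ts) p | yes q with Alm? U (λ i → NN (⟦ T₁ ⟧ ρ i - ⟦ T₀ ⟧ ρ i))
... | yes T₀≤T₁ with greatest U ρ y T₁ Ts q
...   | S , S∈ , S≤y , max = S , there S∈ , S≤y , λ
  { (here refl) t → map₂ U (λ i → NN--trans (⟦ S ⟧ ρ i) (⟦ T₁ ⟧ ρ i) (⟦ T₀ ⟧ ρ i)) (max (here refl) q) T₀≤T₁
  ; (there T∈)  t → max T∈ t }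
greatest U ρ y T₀ (T₁ ∷ Ts) p | yes q | no T₀≰T₁ with greatest U ρ y T₀ Ts p
... | S , S∈ , S≤y , max = S , weaken S∈ , S≤y , λ
  { (here refl)         t → max (here refl) t
  ; (there (here refl)) t → map₂ U (λ i → NN--trans (⟦ S ⟧ ρ i) (⟦ T₀ ⟧ ρ i) (⟦ T₁ ⟧ ρ i)) (max (here refl) p)
      (map₁ U (λ i → ¬NN--flip (⟦ T₁ ⟧ ρ i) (⟦ T₀ ⟧ ρ i)) (¬Alm⇒Alm¬ U T₀≰T₁))
  ; (there (there T∈))  t → max (there T∈) t }
  where
  weaken : ∀ {S} → S ∈ T₀ ∷ Ts → S ∈ T₀ ∷ T₁ ∷ Ts
  weaken (here e)  = here e
  weaken (there e) = there (there e)

-- Their signs tell, for any two thresholds, which standard shifts t < `N` carry the first to the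
-- second or beyond it.
gapForms : ∀ {k} → List (Lin k) → ℕ → List (Lin k)
gapForms Ts N =
  concatMap (λ S → concatMap (λ T → map (λ t → (S ⊞ con (+ t)) ⊟ T) (upTo N)) Ts) Ts

∈-gapForms : ∀ {k} {Ts : List (Lin k)} {N S T t} → S ∈ Ts → T ∈ Ts → t < N →
             ((S ⊞ con (+ t)) ⊟ T) ∈ gapForms Ts N
∈-gapForms {Ts = Ts} {N} {S} S∈ T∈ t<N =
  ∈-concatMap (λ S → concatMap (λ T → map (λ t → (S ⊞ con (+ t)) ⊟ T) (upTo N)) Ts) S∈
    (∈-concatMap (λ T → map (λ t → (S ⊞ con (+ t)) ⊟ T) (upTo N)) T∈
      (∈-map⁺ _ (∈-upTo⁺ t<N)))

-- The constant 0 joins the thresholds so that the greatest one below D x is nonnegative and the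
-- reply is a natural number. Residues modulo D M control both divisibility by `D` and the residue
-- of the quotient modulo `M`.
gapRequirement : ∀ {k} → List (Lin k) → ∀ D M → 1 ≤ D → 1 ≤ M → Requirement k
gapRequirement Ts D M 1≤D 1≤M =
  req (gapForms (con 0ℤ ∷ Ts) (D ℕ.* M)) (D ℕ.* M) (ℕP.*-mono-≤ 1≤D 1≤M)

-- If S is the greatest threshold below D x, then D x may be moved down to the
-- first point of its residue class above S, which is a standard distance from S.
respond : ∀ {U U' k} (Ts : List (Lin k)) {D M} (1≤D : 1 ≤ D) (1≤M : 1 ≤ M) {ρ ρ'} →
  Agree U U' (gapRequirement Ts D M 1≤D 1≤M) ρ ρ' → (x : ℕ → ℕ) →
  ∃[ x' ] CommonResidue U U' M (λ i → + x i) (λ i → + x' i) ×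
          (∀ {T} → T ∈ Ts → Alm U  (λ i → NN (+ D * + x  i - ⟦ T ⟧ ρ  i)) ⇔
                            Alm U' (λ i → NN (+ D * + x' i - ⟦ T ⟧ ρ' i)))
respond {U} {U'} Ts {D} {M} 1≤D 1≤M {ρ} {ρ'} (agree signs residues) x
  with greatest U ρ (λ i → + D * + x i) (con 0ℤ) Ts
         (always U (λ i → subst NN (lem (+ D) (+ x i)) (NN-* (NN-ℕ {D}) (NN-ℕ {x i}))))
  where
  lem : ∀ d x → d * x ≡ d * x - 0ℤ
  lem = solve-∀
... | S , S∈ , S≤Dx , max
  with constantResidue U (λ i → + D * + x i - ⟦ S ⟧ ρ i) (D ℕ.* M) (ℕP.*-mono-≤ 1≤D 1≤M) S≤Dx
     | constantResidue U (λ i → + x i) M 1≤M (always U (λ _ → NN-ℕ))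
     | SameResidues-⟦⟧ {U} {U'} S ρ ρ' residues
... | g , g<DM , gap | r , r<M , resx | s , ress , ress' =
  x' , (+ r , map₁ U residue-x resx , map₁ U' (λ _ → proj₂) x'-spec) , same
  where
  -- The reply is (S' + g) / D, where g is the standard remainder of D x - S modulo D M. The
  -- division is exact almost everywhere.
  x' : ℕ → ℕ
  x' i = proj₁ (euclid ∣ ⟦ S ⟧ ρ' i + + g ∣ D)

  residue-x : ∀ i → ∃[ q ] + x i ≡ + q * + M + + r → Congruent M (+ x i) (+ r)
  residue-x i (q , eq) = divides (+ q) (trans (cong (_- + r) eq) (lem (+ q) (+ M) (+ r)))
    where
    lem : ∀ q m r → (q * m + r) - r ≡ q * m
    lem = solve-∀

  -- Only standard integers occur in this divisibility, so it can be read off on the side of `U` and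
  -- used on the side of `U'`.
  standard : + (D ℕ.* M) ∣ (+ D * + r - (s + + g))
  standard = Alm-dec U (+ (D ℕ.* M) ∣? _) (map₃ U pointwise gap resx ress)
    where
    lem : ∀ D M N X S r g q q' s k → N ≡ D * M → X ≡ q' * M + r → D * X - S ≡ q * N + g → S - s ≡ k * N →
          D * r - (s + g) ≡ (q + k - q') * N
    lem D M _ _ S r g q q' s k refl refl e₁ e₂ =
      trans (eq₁ D M S r g q' s) (trans (cong₂ (λ u v → u - g + v - q' * (D * M)) e₁ e₂) (eq₂ (D * M) g q q' k))
      where
      eq₁ : ∀ D M S r g q' s → D * r - (s + g) ≡ (D * (q' * M + r) - S) - g + (S - s) - q' * (D * M)
      eq₁ = solve-∀
      eq₂ : ∀ N g q q' k → (q * N + g) - g + k * N - q' * N ≡ (q + k - q') * N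
      eq₂ = solve-∀
    pointwise : ∀ i → ∃[ q ] + D * + x i - ⟦ S ⟧ ρ i ≡ + q * + (D ℕ.* M) + + g →
                ∃[ q ] + x i ≡ + q * + M + + r → Congruent (D ℕ.* M) (⟦ S ⟧ ρ i) s →
                + (D ℕ.* M) ∣ (+ D * + r - (s + + g))
    pointwise i (q , e) (q' , e') (divides k e'') =
      divides (+ q + k - + q')
        (lem (+ D) (+ M) _ _ (⟦ S ⟧ ρ i) (+ r) (+ g) (+ q) (+ q') s k (ℤP.pos-* D M) e' e e'')

  -- The threshold 0 lies below D x, so the greatest such threshold is at least 0, and this sign
  -- transfers.
  S'≥0 : Alm U' (λ i → NN (⟦ S ⟧ ρ' i))
  S'≥0 = map₁ U' (λ i → subst NN (simp (⟦ S ⟧ ρ' i)))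
           (to (signs (∈-gapForms S∈ (here refl) (ℕP.*-mono-≤ 1≤D 1≤M)))
             (map₁ U (λ i → subst NN (simp' (⟦ S ⟧ ρ i))) (max (here refl)
               (always U (λ i → subst NN (simp″ (+ D) (+ x i)) (NN-* (NN-ℕ {D}) (NN-ℕ {x i})))))))
    where
    simp : ∀ s → (s + 0ℤ) + -1ℤ * 0ℤ ≡ s
    simp = solve-∀
    simp' : ∀ s → s - 0ℤ ≡ (s + 0ℤ) + -1ℤ * 0ℤ
    simp' = solve-∀
    simp″ : ∀ d x → d * x ≡ d * x - 0ℤ
    simp″ = solve-∀

  x'-spec : Alm U' (λ i → + D * + x' i ≡ ⟦ S ⟧ ρ' i + + g × Congruent M (+ x' i) (+ r))
  x'-spec = map₂ U' pointwise S'≥0 ress'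
    where
    lem : ∀ D M N S r g s k q → N ≡ D * M → S - s ≡ k * N → D * r - (s + g) ≡ q * N →
          S + g ≡ D * (r + (k - q) * M)
    lem D M _ S r g s k q refl e₁ e₂ =
      trans (eq₁ D S r g s) (trans (cong₂ (λ u v → u - v + D * r) e₁ e₂) (eq₂ D M r k q))
      where
      eq₁ : ∀ D S r g s → S + g ≡ (S - s) - (D * r - (s + g)) + D * r
      eq₁ = solve-∀
      eq₂ : ∀ D M r k q → k * (D * M) - q * (D * M) + D * r ≡ D * (r + (k - q) * M)
      eq₂ = solve-∀
    lem′ : ∀ r k m → (r + k * m) - r ≡ k * m
    lem′ = solve-∀
    exact : ∀ Y z → NN Y → Y ≡ + D * z → + D * + proj₁ (euclid ∣ Y ∣ D) ≡ Y × + proj₁ (euclid ∣ Y ∣ D) ≡ z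
    exact Y z nn refl with NN-∃ (NN-cancel {D} {z} 1≤D nn)
    ... | w , refl = cong (λ v → + D * + v) quot , cong +_ quot
      where
      quot : proj₁ (euclid ∣ + D * + w ∣ D) ≡ w
      quot = trans (cong (λ v → proj₁ (euclid v D)) (trans (ℤP.abs-* (+ D) (+ w)) (ℕP.*-comm D w))) (euclid-* w D 1≤D)
    pointwise : ∀ i → NN (⟦ S ⟧ ρ' i) → Congruent (D ℕ.* M) (⟦ S ⟧ ρ' i) s →
                + D * + x' i ≡ ⟦ S ⟧ ρ' i + + g × Congruent M (+ x' i) (+ r)
    pointwise i nn (divides k e) with standard
    ... | divides q e'
      with exact (⟦ S ⟧ ρ' i + + g) _ (NN-+ nn (NN-ℕ {g}))
             (lem (+ D) (+ M) _ (⟦ S ⟧ ρ' i) (+ r) (+ g) s k q (ℤP.pos-* D M) e e')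
    ... | Dx'≡ , x'≡ = Dx'≡ , divides (k - q) (trans (cong (_- + r) x'≡) (lem′ (+ r) (k - q) (+ M)))

  Dx'≡S'+g : Alm U' (λ i → + D * + x' i ≡ ⟦ S ⟧ ρ' i + + g)
  Dx'≡S'+g = map₁ U' (λ _ → proj₁) x'-spec

  same : ∀ {T} → T ∈ Ts → Alm U  (λ i → NN (+ D * + x  i - ⟦ T ⟧ ρ  i)) ⇔
                          Alm U' (λ i → NN (+ D * + x' i - ⟦ T ⟧ ρ' i))
  same {T} T∈ with Alm? U (λ i → NN (+ D * + x i - ⟦ T ⟧ ρ i))
  -- By maximality T ≤ S; hence T' ≤ S' on the other side, and S' ≤ S' + g = D x'.
  ... | yes p = mk⇔ (λ _ → map₂ U' below Dx'≡S'+g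
                       (to (signs (∈-gapForms S∈ (there T∈) (ℕP.*-mono-≤ 1≤D 1≤M)))
                         (map₁ U (λ i → subst NN (simp (⟦ S ⟧ ρ i) (⟦ T ⟧ ρ i))) (max (there T∈) p))))
                    (λ _ → p)
    where
    simp : ∀ s t → s - t ≡ (s + 0ℤ) + -1ℤ * t
    simp = solve-∀
    below : ∀ i → + D * + x' i ≡ ⟦ S ⟧ ρ' i + + g → NN ((⟦ S ⟧ ρ' i + 0ℤ) + -1ℤ * ⟦ T ⟧ ρ' i) →
            NN (+ D * + x' i - ⟦ T ⟧ ρ' i)
    below i e nn rewrite e = subst NN (shift (⟦ S ⟧ ρ' i) (⟦ T ⟧ ρ' i) (+ g)) (NN-+ nn (NN-ℕ {g}))
      where
      shift : ∀ s t g → ((s + 0ℤ) + -1ℤ * t) + g ≡ (s + g) - t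
      shift = solve-∀
  -- If T' ≤ S' + g, then T ≤ S + g, and S + g ≤ D x because g is a remainder of the nonnegative gap
  -- D x - S.
  ... | no ¬p = mk⇔ (λ p → ⊥-elim (¬p p))
                    (λ p' → ⊥-elim (¬p (map₂ U above gap
                       (from (signs (∈-gapForms S∈ (there T∈) g<DM)) (map₂ U' transfer Dx'≡S'+g p')))))
    where
    transfer : ∀ i → + D * + x' i ≡ ⟦ S ⟧ ρ' i + + g → NN (+ D * + x' i - ⟦ T ⟧ ρ' i) →
               NN ((⟦ S ⟧ ρ' i + + g) + -1ℤ * ⟦ T ⟧ ρ' i)
    transfer i e nn rewrite e = subst NN (simp (⟦ S ⟧ ρ' i + + g) (⟦ T ⟧ ρ' i)) nn
      where
      simp : ∀ s t → s - t ≡ s + -1ℤ * t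
      simp = solve-∀
    above : ∀ i → ∃[ q ] + D * + x i - ⟦ S ⟧ ρ i ≡ + q * + (D ℕ.* M) + + g →
            NN ((⟦ S ⟧ ρ i + + g) + -1ℤ * ⟦ T ⟧ ρ i) → NN (+ D * + x i - ⟦ T ⟧ ρ i)
    above i (q , e) nn =
      subst NN (trans (cong (λ v → v - + g + (⟦ S ⟧ ρ i + + g + -1ℤ * ⟦ T ⟧ ρ i)) (sym e))
                      (simp (+ D * + x i) (⟦ S ⟧ ρ i) (⟦ T ⟧ ρ i) (+ g)))
               (subst NN (simp' (+ q * + (D ℕ.* M)) (+ g) (⟦ S ⟧ ρ i + + g + -1ℤ * ⟦ T ⟧ ρ i))
                         (NN-+ (NN-* (NN-ℕ {q}) (NN-ℕ {D ℕ.* M})) nn))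
      where
      simp' : ∀ v g w → v + w ≡ (v + g) - g + w
      simp' = solve-∀
      simp : ∀ y s t g → (y - s) - g + (s + g + -1ℤ * t) ≡ y - t
      simp = solve-∀

-- Normalising the coefficient of the new variable

data Multiple (D : ℕ) (c : ℤ) : Set where
  zero : c ≡ 0ℤ → Multiple D c
  pos  : ∀ e → 1 ≤ e → + e * c ≡ + D → Multiple D c
  neg  : ∀ e → 1 ≤ e → + e * c ≡ - (+ D) → Multiple D c

Multiple-* : ∀ {D c} f → 1 ≤ f → Multiple D c → Multiple (f ℕ.* D) c
Multiple-* f 1≤f (zero e) = zero e
Multiple-* {D} {c} f 1≤f (pos e 1≤e eq) =
  pos (f ℕ.* e) (ℕP.*-mono-≤ 1≤f 1≤e)
    (trans (cong (_* c) (ℤP.pos-* f e))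
      (trans (ℤP.*-assoc (+ f) (+ e) c) (trans (cong (+ f *_) eq) (sym (ℤP.pos-* f D)))))
Multiple-* {D} {c} f 1≤f (neg e 1≤e eq) =
  neg (f ℕ.* e) (ℕP.*-mono-≤ 1≤f 1≤e)
    (trans (cong (_* c) (ℤP.pos-* f e))
      (trans (ℤP.*-assoc (+ f) (+ e) c) (trans (cong (+ f *_) eq)
        (trans (sym (ℤP.neg-distribʳ-* (+ f) (+ D))) (cong -_ (sym (ℤP.pos-* f D)))))))

commonMultiple : ∀ (cs : List ℤ) → ∃[ D ] 1 ≤ D × All (Multiple D) cs
commonMultiple [] = 1 , ℕP.≤-refl , []
commonMultiple (c ∷ cs) with commonMultiple cs
commonMultiple (+ zero ∷ cs)   | D , 1≤D , ms = D , 1≤D , zero refl ∷ ms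
commonMultiple (+ suc c ∷ cs)  | D , 1≤D , ms =
  suc c ℕ.* D , ℕP.*-mono-≤ {1} {suc c} (ℕ.s≤s ℕ.z≤n) 1≤D ,
  pos D 1≤D (trans (ℤP.*-comm (+ D) (+ suc c)) (sym (ℤP.pos-* (suc c) D))) ∷
  All.map (Multiple-* (suc c) (ℕ.s≤s ℕ.z≤n)) ms
commonMultiple (-[1+ c ] ∷ cs) | D , 1≤D , ms =
  suc c ℕ.* D , ℕP.*-mono-≤ {1} {suc c} (ℕ.s≤s ℕ.z≤n) 1≤D ,
  neg D 1≤D (trans (ℤP.*-comm (+ D) -[1+ c ])
    (trans (sym (ℤP.neg-distribˡ-* (+ suc c) (+ D))) (cong -_ (sym (ℤP.pos-* (suc c) D))))) ∷
  All.map (Multiple-* (suc c) (ℕ.s≤s ℕ.z≤n)) ms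

-- An upper bound is encoded as the negation of a lower bound, so that a reply only has to be
-- compared with lower bounds on D x. Scaling each form by a positive factor lets one `D` serve all
-- of them.
data Threshold (D : ℕ) {k} (F : Lin (suc k)) : Set where
  free  : ∀ L → (∀ x ρ i → NN (⟦ F ⟧ (x ∷ ρ) i) ⇔ NN (⟦ L ⟧ ρ i)) → Threshold D F
  lower : ∀ T → (∀ x ρ i → NN (⟦ F ⟧ (x ∷ ρ) i) ⇔ NN (+ D * + x i - ⟦ T ⟧ ρ i)) → Threshold D F
  upper : ∀ T → (∀ x ρ i → NN (⟦ F ⟧ (x ∷ ρ) i) ⇔ (¬ NN (+ D * + x i - ⟦ T ⟧ ρ i))) → Threshold D F

NN-scale : ∀ {e z w} → 1 ≤ e → + e * z ≡ w → NN z ⇔ NN w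
NN-scale {e} 1≤e refl = mk⇔ (NN-* (NN-ℕ {e})) (NN-cancel 1≤e)

¬NN⇔ : ∀ {z w} → -1ℤ - z ≡ w → (¬ NN z) ⇔ NN w
¬NN⇔ refl = mk⇔ ¬NN⇒ NN⇒¬

⇔-trans : ∀ {A B C : Set} → A ⇔ B → B ⇔ C → A ⇔ C
⇔-trans f g = g ⇔-∘ f

threshold : ∀ {D k} (F : Lin (suc k)) → Multiple D (coef F) → Threshold D F
threshold F (zero c≡0) = free (rest F) λ x ρ i → NN-≡ (trans (⟦⟧-split F x ρ i)
  (trans (cong (λ c → c * + x i + ⟦ rest F ⟧ ρ i) c≡0) (lem (+ x i) (⟦ rest F ⟧ ρ i))))
  where
  lem : ∀ x l → 0ℤ * x + l ≡ l
  lem = solve-∀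
  NN-≡ : ∀ {x y} → x ≡ y → NN x ⇔ NN y
  NN-≡ refl = mk⇔ (λ p → p) (λ p → p)
threshold {D} F (pos e 1≤e eq) = lower (- (+ e) ⊡ rest F) λ x ρ i → NN-scale 1≤e
  (trans (cong (+ e *_) (⟦⟧-split F x ρ i)) (lem (+ e) (coef F) (+ D) (+ x i) (⟦ rest F ⟧ ρ i) eq))
  where
  lem : ∀ e c D x l → e * c ≡ D → e * (c * x + l) ≡ D * x - - e * l
  lem e c _ x l refl = ring e c x l
    where
    ring : ∀ e c x l → e * (c * x + l) ≡ e * c * x - - e * l
    ring = solve-∀
-- Scaled by `e`, the form becomes e l - D x with l the value of `rest F`, and D x ≤ e l is the
-- negation of D x ≥ e l + 1.
threshold {D} F (neg e 1≤e eq) = upper (+ e ⊡ rest F ⊞ con 1ℤ) λ x ρ i → ⇔-trans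
  (NN-scale 1≤e (cong (+ e *_) (⟦⟧-split F x ρ i)))
  (⇔-sym (¬NN⇔ (lem (+ e) (coef F) (+ D) (+ x i) (⟦ rest F ⟧ ρ i) eq)))
  where
  lem : ∀ e c D x l → e * c ≡ - D → -1ℤ - (D * x - (e * l + 1ℤ)) ≡ e * (c * x + l)
  lem e c D x l eq = trans (ring₁ e D x l) (trans (cong (λ v → v * x + e * l) (sym eq)) (ring₂ e c x l))
    where
    ring₁ : ∀ e D x l → -1ℤ - (D * x - (e * l + 1ℤ)) ≡ (- D) * x + e * l
    ring₁ = solve-∀
    ring₂ : ∀ e c x l → (e * c) * x + e * l ≡ e * (c * x + l)
    ring₂ = solve-∀

frees : ∀ {D k} {Φ : List (Lin (suc k))} → All (Threshold D) Φ → List (Lin k)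
frees []              = []
frees (free L _ ∷ hs) = L ∷ frees hs
frees (_        ∷ hs) = frees hs

thresholds : ∀ {D k} {Φ : List (Lin (suc k))} → All (Threshold D) Φ → List (Lin k)
thresholds []               = []
thresholds (free _ _  ∷ hs) = thresholds hs
thresholds (lower T _ ∷ hs) = T ∷ thresholds hs
thresholds (upper T _ ∷ hs) = T ∷ thresholds hs

-- Quantified over all pairs of ultrafilters, so that by the symmetry of `Agree` it answers moves
-- made on either side.
Extends : ∀ {k} → Requirement k → Requirement (suc k) → Set₁
Extends Q' Q = ∀ {U U' ρ ρ'} → Agree U U' Q' ρ ρ' → ∀ x → ∃[ x' ] Agree U U' Q (x ∷ ρ) (x' ∷ ρ')

Alm-⇔ : ∀ U {A B : Subset} → (∀ i → A i ⇔ B i) → Alm U A ⇔ Alm U B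
Alm-⇔ U f = mk⇔ (map₁ U (λ i → to (f i))) (map₁ U (λ i → from (f i)))

Alm-¬ : ∀ {U U'} {A B : Subset} → Alm U A ⇔ Alm U' B → Alm U (λ i → ¬ A i) ⇔ Alm U' (λ i → ¬ B i)
Alm-¬ {U} {U'} f = mk⇔
  (λ ¬a → ¬Alm⇒Alm¬ U' (λ b → Alm-disjoint U (λ i a ¬a → ¬a a) (from f b) ¬a))
  (λ ¬b → ¬Alm⇒Alm¬ U (λ a → Alm-disjoint U' (λ i a ¬a → ¬a a) (to f a) ¬b))

module _ (U U' : Ultrafilter) (D : ℕ) {k : ℕ} (ρ ρ' : Env k) (x x' : ℕ → ℕ) where

  sameSign : ∀ {Φ} (hs : All (Threshold D) Φ) →
    (∀ {L} → L ∈ frees hs → SameSign U U' ρ ρ' L) →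
    (∀ {T} → T ∈ thresholds hs → Alm U  (λ i → NN (+ D * + x  i - ⟦ T ⟧ ρ  i)) ⇔
                                 Alm U' (λ i → NN (+ D * + x' i - ⟦ T ⟧ ρ' i))) →
    ∀ {F} → F ∈ Φ → SameSign U U' (x ∷ ρ) (x' ∷ ρ') F
  sameSign (free L h ∷ hs) f g (here refl) =
    ⇔-trans (Alm-⇔ U (h x ρ)) (⇔-trans (f (here refl)) (⇔-sym (Alm-⇔ U' (h x' ρ'))))
  sameSign (lower T h ∷ hs) f g (here refl) =
    ⇔-trans (Alm-⇔ U (h x ρ)) (⇔-trans (g (here refl)) (⇔-sym (Alm-⇔ U' (h x' ρ'))))
  sameSign (upper T h ∷ hs) f g (here refl) =
    ⇔-trans (Alm-⇔ U (h x ρ)) (⇔-trans (Alm-¬ {U} {U'} (g (here refl))) (⇔-sym (Alm-⇔ U' (h x' ρ'))))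
  sameSign (free L h ∷ hs)  f g (there F∈) = sameSign hs (λ L∈ → f (there L∈)) g F∈
  sameSign (lower T h ∷ hs) f g (there F∈) = sameSign hs f (λ T∈ → g (there T∈)) F∈
  sameSign (upper T h ∷ hs) f g (there F∈) = sameSign hs f (λ T∈ → g (there T∈)) F∈

module _ {k D M : ℕ} {Φ : List (Lin (suc k))} (1≤D : 1 ≤ D) (1≤M : 1 ≤ M) (hs : All (Threshold D) Φ) where

  freeRequirement thresholdRequirement : Requirement k
  freeRequirement      = req (frees hs) 1 ℕP.≤-refl
  thresholdRequirement = gapRequirement (thresholds hs) D M 1≤D 1≤M

  extendThresholds : Extends (freeRequirement ∪ thresholdRequirement) (req Φ M 1≤M)
  extendThresholds {U} {U'} {ρ} {ρ'} ag x =
    proj₁ response ,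
    agree (sameSign U U' D ρ ρ' x (proj₁ response) hs (signs agˡ) (proj₂ (proj₂ response)))
          (proj₁ (proj₂ response) ,
           SameResidues-∣ ρ ρ' (divides (+ D) (ℤP.pos-* D M)) (residues agʳ))
    where
    agˡ : Agree U U' freeRequirement ρ ρ'
    agˡ = Agree-∪ˡ {Q = freeRequirement} {R = thresholdRequirement} ag
    agʳ : Agree U U' thresholdRequirement ρ ρ'
    agʳ = Agree-∪ʳ {Q = freeRequirement} {R = thresholdRequirement} ag
    response = respond {U} {U'} (thresholds hs) 1≤D 1≤M {ρ} {ρ'} agʳ x

-- The game form of eliminating a quantifier in Presburger arithmetic: after scaling, the new
-- variable enters only through comparisons of D x with forms in the old variables, and through its
-- residue.
extend : ∀ {k} (Q : Requirement (suc k)) → Σ[ Q' ∈ Requirement k ] Extends Q' Q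
extend (req Φ M 1≤M) with commonMultiple (map coef Φ)
... | D , 1≤D , ms = _ , extendThresholds 1≤D 1≤M (All.map (λ {F} → threshold F) (AllP.map⁻ ms))

-- Elements of the ultraproduct and the order on terms

Alm-⇔-on : ∀ U {A B : Subset} → Alm U (λ i → A i ⇔ B i) → Alm U A ⇔ Alm U B
Alm-⇔-on U h = mk⇔ (map₂ U (λ i f → to f) h) (map₂ U (λ i f → from f) h)

offset : ℕ → ℕ → ℤ
offset B j = + j - + B

-- ⌊Y / A⌋ = j - B for A > 0; the shift keeps the index j a natural number.
Floor : ℤ → ℤ → ℕ → ℕ → Set
Floor A Y B j = NN (Y + -1ℤ * (offset B j * A)) × ¬ NN (Y + -1ℤ * (offset B (suc j) * A))

-- The left side says X + Y / a ≥ 0; since X is an integer, Y / a may be replaced by its floor.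
floor-sign : ∀ {a X Y B j} → Floor (+ a) Y B j → NN (+ a * X + Y) ⇔ NN (X + offset B j)
floor-sign {a} {X} {Y} {B} {j} (lo , hi) = mk⇔ fwd bwd
  where
  bwd : NN (X + offset B j) → NN (+ a * X + Y)
  bwd p = subst NN (ring (+ a) X Y (offset B j)) (NN-+ (NN-* (NN-ℕ {a}) p) lo)
    where
    ring : ∀ a X Y τ → a * (X + τ) + (Y + -1ℤ * (τ * a)) ≡ a * X + Y
    ring = solve-∀
  fwd : NN (+ a * X + Y) → NN (X + offset B j)
  fwd p with 0ℤ ℤ.≤? (X + offset B j)
  ... | yes q = q
  ... | no ¬q = ⊥-elim (hi (subst NN (ring (+ a) X Y (+ j) (+ B)) (NN-+ p (NN-* (NN-ℕ {a}) (¬NN⇒ ¬q)))))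
    where
    ring : ∀ a X Y j B → a * X + Y + a * (-1ℤ - (X + (j - B))) ≡ Y + -1ℤ * ((1ℤ + j - B) * a)
    ring = solve-∀

crossing : ∀ {P : ℕ → Set} → (∀ j → Dec (P j)) → ∀ N → P 0 → ¬ P N → ∃[ j ] j < N × P j × ¬ P (suc j)
crossing P? zero    p ¬p = ⊥-elim (¬p p)
crossing P? (suc N) p ¬p with P? N
... | yes q = N , ℕP.≤-refl , q , ¬p
... | no ¬q with crossing P? N p ¬q
...   | j , j<N , r = j , ℕP.m<n⇒m<1+n j<N , r

-- A floor between -B and B has index at most 2 B, and the failing inequality that pins it down sits
-- at the next index; hence 2 B + 2 indices.
floorForms : ∀ {k} → Lin k → Lin k → ℕ → List (Lin k)
floorForms A Y B = map (λ j → Y ⊟ (offset B j ⊡ A)) (upTo (2 ℕ.+ (B ℕ.+ B)))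

module _ {k} (U U' : Ultrafilter) (ρ ρ' : Env k) (A Y : Lin k) (B : ℕ) where

  -- The bounds leave finitely many floors for Y / A, and the two inequalities that single one out
  -- are signs shared by both sides. `A≥1` makes the inequality fail at index 2 B + 1, so a crossing
  -- exists.
  commonFloor : (∀ {F} → F ∈ floorForms A Y B → SameSign U U' ρ ρ' F) →
    Alm U (λ i → NN (⟦ A ⟧ ρ i - 1ℤ)) →
    Alm U (λ i → NN (⟦ Y ⟧ ρ i + + B * ⟦ A ⟧ ρ i)) →
    Alm U (λ i → NN (+ B * ⟦ A ⟧ ρ i - ⟦ Y ⟧ ρ i)) →
    ∃[ j ] j < suc (B ℕ.+ B) × Alm U  (λ i → Floor (⟦ A ⟧ ρ  i) (⟦ Y ⟧ ρ  i) B j)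
                               × Alm U' (λ i → Floor (⟦ A ⟧ ρ' i) (⟦ Y ⟧ ρ' i) B j)
  commonFloor sgn A≥1 lo hi
    with crossing {λ j → Alm U (λ i → NN (⟦ Y ⊟ (offset B j ⊡ A) ⟧ ρ i))} (λ j → Alm? U _) (suc (B ℕ.+ B))
           (map₁ U (λ i → subst NN (ring₁ (⟦ Y ⟧ ρ i) (+ B) (⟦ A ⟧ ρ i))) lo)
           (λ p → proper U (map₃ U (λ i x y z →
              absurd (subst NN (ring₂ (⟦ Y ⟧ ρ i) (+ B) (⟦ A ⟧ ρ i)) (NN-+ x (NN-+ y z)))) A≥1 hi p))
    where
    ring₁ : ∀ Y B A → Y + B * A ≡ Y + -1ℤ * ((0ℤ - B) * A)
    ring₁ = solve-∀
    ring₂ : ∀ Y B A → (A - 1ℤ) + ((B * A - Y) + (Y + -1ℤ * ((1ℤ + (B + B) - B) * A))) ≡ -1ℤ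
    ring₂ = solve-∀
    absurd : ¬ NN -1ℤ
    absurd ()
  ... | j , j<N , p , ¬p =
    j , j<N , intersect U _ _ p (¬Alm⇒Alm¬ U ¬p)
            , intersect U' _ _ (to (sgn (j∈ (ℕP.m<n⇒m<1+n j<N))) p)
                               (¬Alm⇒Alm¬ U' (λ q → ¬p (from (sgn (j∈ (ℕ.s≤s j<N))) q)))
    where
    j∈ : ∀ {j} → j < 2 ℕ.+ (B ℕ.+ B) → (Y ⊟ (offset B j ⊡ A)) ∈ floorForms A Y B
    j∈ j< = ∈-map⁺ _ (∈-upTo⁺ j<)

-- Two carries: the floor of L₃ by a is added to L₂, and the floor of the result by C is added to
-- L₁. The first carry is a standard number, so it enters the second floor as a mere constant.
two-floors : ∀ {m a C Z L₁ L₂ L₃ B₁ j₁ B₂ j₂} → 1 ≤ m → + m * Z ≡ + a * (+ C * L₁ + L₂) + L₃ →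
  Floor (+ a) L₃ B₁ j₁ → Floor (+ C) (L₂ + offset B₁ j₁) B₂ j₂ → NN Z ⇔ NN (L₁ + offset B₂ j₂)
two-floors {m} {a} {C} {Z} {L₁} {L₂} {L₃} {B₁} {j₁} {B₂} {j₂} 1≤m eq f₁ f₂ =
  ⇔-trans (NN-scale {m} {Z} 1≤m eq)
    (⇔-trans (floor-sign {a} {+ C * L₁ + L₂} {L₃} {B₁} {j₁} f₁)
      (subst (λ v → NN v ⇔ NN (L₁ + offset B₂ j₂)) (sym (ℤP.+-assoc (+ C * L₁) L₂ (offset B₁ j₁)))
        (floor-sign {C} {L₁} {L₂ + offset B₁ j₁} {B₂} {j₂} f₂)))

-- Digits of elements and expansion of terms

twice : ℕ → ℕ
twice zero    = zero
twice (suc k) = suc (suc (twice k))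

-- The interface between admissible pairs and the game. The conditions are imposed almost
-- everywhere, since a natural cofactor `C` may fail to exist at indices where a is small.
record Model (m n : ℕ) : Set₁ where
  field
    U        : Ultrafilter
    a b C    : ℕ → ℕ
    a≥1      : Alm U (λ i → 1 ≤ a i)
    C≥1      : Alm U (λ i → 1 ≤ C i)
    relation : Alm U (λ i → m ℕ.* b i ≡ a i ℕ.* C i ℕ.+ n)

  S : Structure
  S = Ultraproduct a b U

  value : Structure.Carrier S → ℕ → ℕ
  value = proj₁

  -- σ lists v and p for each element of ρ, followed by a; τ lists e for each element, followed by C.
  data Digits : ∀ {k} → Vec (Structure.Carrier S) k → Env (suc (twice k)) → Env (suc k) → Set where
    []  : Digits [] (a ∷ []) (C ∷ [])
    add : ∀ {k} {ρ : Vec (Structure.Carrier S) k} {σ τ} {x v p e} → Digits ρ σ τ →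
          Alm U (λ i → value x i ≡ (p i ℕ.* C i ℕ.+ e i) ℕ.* a i ℕ.+ v i ℕ.* b i) →
          Alm U (λ i → v i < a i) → Alm U (λ i → e i < C i) →
          Digits (x ∷ ρ) (v ∷ p ∷ σ) (e ∷ τ)

open Model

aVar : ∀ k → Lin (suc (twice k))
aVar zero    = top
aVar (suc k) = wk (wk (aVar k))

CVar : ∀ k → Lin (suc k)
CVar zero    = top
CVar (suc k) = wk (CVar k)

vVar pVar : ∀ {k} → Fin k → Lin (suc (twice k))
vVar zero    = top
vVar (suc j) = wk (wk (vVar j))
pVar zero    = wk top
pVar (suc j) = wk (wk (pVar j))

eVar : ∀ {k} → Fin k → Lin (suc k)
eVar zero    = top
eVar (suc j) = wk (eVar j)

size : ∀ {k} → Term k → ℕ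
size (var _)  = 1
size zer      = 0
size (s +ₜ t) = size s ℕ.+ size t

linear : ∀ {k l} → (Fin k → Lin l) → Term k → Lin l
linear f (var j)  = f j
linear f zer      = con 0ℤ
linear f (s +ₜ t) = linear f s ⊞ linear f t

module _ {m n : ℕ} (𝓜 : Model m n) where

  ⟦aVar⟧ : ∀ {k ρ σ τ} → Digits 𝓜 {k} ρ σ τ → ∀ i → ⟦ aVar k ⟧ σ i ≡ + a 𝓜 i
  ⟦aVar⟧ []            i = refl
  ⟦aVar⟧ (add d _ _ _) i = ⟦aVar⟧ d i

  ⟦CVar⟧ : ∀ {k ρ σ τ} → Digits 𝓜 {k} ρ σ τ → ∀ i → ⟦ CVar k ⟧ τ i ≡ + C 𝓜 i
  ⟦CVar⟧ []            i = refl
  ⟦CVar⟧ (add d _ _ _) i = ⟦CVar⟧ d i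

Within : ℕ → ℕ → ℤ → Set
Within N A z = NN z × NN (+ N * + A - z)

Within-+ : ∀ N N' A x y → Within N A x → Within N' A y → Within (N ℕ.+ N') A (x + y)
Within-+ N N' A x y (p , q) (p' , q') = NN-+ p p' , subst NN (ring (+ N) (+ N') (+ A) x y) (NN-+ q q')
  where
  ring : ∀ N N' A x y → (N * A - x) + (N' * A - y) ≡ (N + N') * A - (x + y)
  ring = solve-∀

Within-1 : ∀ {x A} → x < A → Within 1 A (+ x)
Within-1 {x} {A} p = NN-ℕ , subst (λ v → NN (v - + x)) (sym (ℤP.*-identityˡ (+ A))) (≤⇒NN (ℕP.<⇒≤ p))

-- Since m b = a C + n, the coefficient of a C in m ((p C + e) a + v b) is m p + v; this is its sum
-- over the variables of a term.
pForm : ∀ {k} → ℕ → Term k → Lin (suc (twice k))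
pForm m = linear (λ j → (+ m ⊡ pVar j) ⊞ vVar j)

-- `Q` and `R` sum the digits e and v over the `N` occurrences of variables in a term; e < C and v <
-- a give the two bounds.
record Expansion (m n A C X : ℕ) (P Q R : ℤ) (N : ℕ) : Set where
  constructor expansion
  field
    expand  : + m * + X ≡ + A * (+ C * P + + m * Q) + + n * R
    withinQ : Within N C Q
    withinR : Within N A R

module _ {m n : ℕ} (𝓜 : Model m n) where

  expandVar : ∀ {k ρ σ τ} → Digits 𝓜 {k} ρ σ τ → ∀ j →
    Alm (U 𝓜) (λ i → Expansion m n (a 𝓜 i) (C 𝓜 i) (value 𝓜 (lookup ρ j) i)
                       (⟦ (+ m ⊡ pVar j) ⊞ vVar j ⟧ σ i) (⟦ eVar j ⟧ τ i) (⟦ vVar j ⟧ σ i) 1)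
  expandVar (add {x = x} {v} {p} {e} _ eq v<a e<C) zero =
    map₂ (U 𝓜) (λ i (x≡ , r) (v< , e<) → expansion
        (ring (+ m) (+ n) (+ a 𝓜 i) (+ b 𝓜 i) (+ C 𝓜 i) (+ v i) (+ p i) (+ e i) (+ value 𝓜 x i)
          (trans (cong +_ x≡) (cast (p i) (C 𝓜 i) (e i) (a 𝓜 i) (v i) (b 𝓜 i)))
          (trans (sym (ℤP.pos-* m (b 𝓜 i))) (trans (cong +_ r) (cong (_+ + n) (ℤP.pos-* (a 𝓜 i) (C 𝓜 i))))))
        (Within-1 e<) (Within-1 v<))
      (intersect (U 𝓜) _ _ eq (relation 𝓜)) (intersect (U 𝓜) _ _ v<a e<C)
    where
    cast : ∀ p C e a v b → + ((p ℕ.* C ℕ.+ e) ℕ.* a ℕ.+ v ℕ.* b) ≡ (+ p * + C + + e) * + a + + v * + b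
    cast p C e a v b = cong₂ _+_ (trans (ℤP.pos-* (p ℕ.* C ℕ.+ e) a) (cong (λ w → (w + + e) * + a) (ℤP.pos-* p C)))
                                 (ℤP.pos-* v b)
    ring : ∀ m n a b C v p e X → X ≡ (p * C + e) * a + v * b → m * b ≡ a * C + n →
           m * X ≡ a * (C * (m * p + v) + m * e) + n * v
    ring m n a b C v p e _ refl r =
      trans (r₁ m a b C v p e) (trans (cong (λ w → m * ((p * C + e) * a) + v * w) r) (r₂ m n a C v p e))
      where
      r₁ : ∀ m a b C v p e → m * ((p * C + e) * a + v * b) ≡ m * ((p * C + e) * a) + v * (m * b)
      r₁ = solve-∀
      r₂ : ∀ m n a C v p e → m * ((p * C + e) * a) + v * (a * C + n) ≡ a * (C * (m * p + v) + m * e) + n * v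
      r₂ = solve-∀
  expandVar (add d _ _ _) (suc j) = expandVar d j

  expandTerm : ∀ {k ρ σ τ} → Digits 𝓜 {k} ρ σ τ → ∀ t →
    Alm (U 𝓜) (λ i → Expansion m n (a 𝓜 i) (C 𝓜 i) (value 𝓜 (evalT (S 𝓜) ρ t) i)
                       (⟦ pForm m t ⟧ σ i) (⟦ linear eVar t ⟧ τ i) (⟦ linear vVar t ⟧ σ i) (size t))
  expandTerm d (var j) = expandVar d j
  expandTerm d zer     = always (U 𝓜) (λ i → expansion (ring (+ m) (+ n) (+ a 𝓜 i) (+ C 𝓜 i)) (NN-ℕ , NN-ℕ) (NN-ℕ , NN-ℕ))
    where
    ring : ∀ m n a C → m * 0ℤ ≡ a * (C * 0ℤ + m * 0ℤ) + n * 0ℤ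
    ring = solve-∀
  expandTerm {ρ = ρ} {σ} {τ} d (s +ₜ t) = map₂ (U 𝓜) sum (expandTerm d s) (expandTerm d t)
    where
    ring : ∀ m n a C X P Q R X' P' Q' R' →
      m * X ≡ a * (C * P + m * Q) + n * R → m * X' ≡ a * (C * P' + m * Q') + n * R' →
      m * (X + X') ≡ a * (C * (P + P') + m * (Q + Q')) + n * (R + R')
    ring m n a C X P Q R X' P' Q' R' e e' =
      trans (ℤP.*-distribˡ-+ m X X') (trans (cong₂ _+_ e e') (r₂ m n a C P Q R P' Q' R'))
      where
      r₂ : ∀ m n a C P Q R P' Q' R' → (a * (C * P + m * Q) + n * R) + (a * (C * P' + m * Q') + n * R') ≡
           a * (C * (P + P') + m * (Q + Q')) + n * (R + R')
      r₂ = solve-∀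
    sum : ∀ i → Expansion m n (a 𝓜 i) (C 𝓜 i) (value 𝓜 (evalT (S 𝓜) ρ s) i)
                  (⟦ pForm m s ⟧ σ i) (⟦ linear eVar s ⟧ τ i) (⟦ linear vVar s ⟧ σ i) (size s) →
                Expansion m n (a 𝓜 i) (C 𝓜 i) (value 𝓜 (evalT (S 𝓜) ρ t) i)
                  (⟦ pForm m t ⟧ σ i) (⟦ linear eVar t ⟧ τ i) (⟦ linear vVar t ⟧ σ i) (size t) →
                Expansion m n (a 𝓜 i) (C 𝓜 i) (value 𝓜 (evalT (S 𝓜) ρ (s +ₜ t)) i)
                  (⟦ pForm m (s +ₜ t) ⟧ σ i) (⟦ linear eVar (s +ₜ t) ⟧ τ i) (⟦ linear vVar (s +ₜ t) ⟧ σ i) (size (s +ₜ t))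
    sum i (expansion e q r) (expansion e' q' r') = expansion
      (ring (+ m) (+ n) (+ a 𝓜 i) (+ C 𝓜 i) (+ value 𝓜 (evalT (S 𝓜) ρ s) i)
        (⟦ pForm m s ⟧ σ i) (⟦ linear eVar s ⟧ τ i) (⟦ linear vVar s ⟧ σ i) (+ value 𝓜 (evalT (S 𝓜) ρ t) i)
        (⟦ pForm m t ⟧ σ i) (⟦ linear eVar t ⟧ τ i) (⟦ linear vVar t ⟧ σ i) e e')
      (Within-+ (size s) (size t) (C 𝓜 i) (⟦ linear eVar s ⟧ τ i) (⟦ linear eVar t ⟧ τ i) q q')
      (Within-+ (size s) (size t) (a 𝓜 i) (⟦ linear vVar s ⟧ σ i) (⟦ linear vVar t ⟧ σ i) r r')

Within-difference : ∀ c N N' A x y → Within N A x → Within N' A y →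
  NN (+ c * (x + -1ℤ * y) + + (c ℕ.* (N' ℕ.+ N)) * + A) ×
  NN (+ (c ℕ.* (N' ℕ.+ N)) * + A - + c * (x + -1ℤ * y))
Within-difference c N N' A x y (p , q) (p' , q') =
  subst (λ M → NN (+ c * (x + -1ℤ * y) + M * + A) × NN (M * + A - + c * (x + -1ℤ * y)))
    (sym (ℤP.pos-* c (N' ℕ.+ N)))
    (subst NN (r₁ (+ c) (+ N) (+ N') (+ A) x y)
       (NN-* (NN-ℕ {c}) (NN-+ p (NN-+ q' (NN-* (NN-ℕ {N}) (NN-ℕ {A}))))) ,
     subst NN (r₂ (+ c) (+ N) (+ N') (+ A) x y)
       (NN-* (NN-ℕ {c}) (NN-+ p' (NN-+ q (NN-* (NN-ℕ {N'}) (NN-ℕ {A}))))))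
  where
  r₁ : ∀ c N N' A x y → c * (x + ((N' * A - y) + N * A)) ≡ c * (x + -1ℤ * y) + c * (N' + N) * A
  r₁ = solve-∀
  r₂ : ∀ c N N' A x y → c * (y + ((N * A - x) + N' * A)) ≡ c * (N' + N) * A - c * (x + -1ℤ * y)
  r₂ = solve-∀

-- Comparison of two terms

module Order (m n : ℕ) (1≤m : 1 ≤ m) where

  module _ {k : ℕ} (s t : Term k) where

    -- `bound₁` bounds the carry of `L₃` past a. The second floor is taken of `L₂` plus that carry;
    -- as C ≥ 1, the carry adds at most `bound₁` times C, whence the summand in `bound₂`.
    bound₁ bound₂ : ℕ
    bound₁ = n ℕ.* (size s ℕ.+ size t)
    bound₂ = m ℕ.* (size s ℕ.+ size t) ℕ.+ bound₁

    L₁ L₃ : Lin (suc (twice k))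
    L₁ = pForm m t ⊟ pForm m s
    L₃ = + n ⊡ (linear vVar t ⊟ linear vVar s)

    L₂ : Lin (suc k)
    L₂ = + m ⊡ (linear eVar t ⊟ linear eVar s)

    ≤-forms₁ : List (Lin (suc (twice k)))
    ≤-forms₁ = floorForms (aVar k) L₃ bound₁ ++
               map (λ j → L₁ ⊞ con (offset bound₂ j)) (upTo (suc (bound₂ ℕ.+ bound₂)))

    -- The first carry depends on the position in the other game, while the requirement is fixed
    -- beforehand; so every possible carry is provided for.
    ≤-forms₂ : List (Lin (suc k))
    ≤-forms₂ = concatMap (λ j → floorForms (CVar k) (L₂ ⊞ con (offset bound₁ j)) bound₂)
                 (upTo (suc (bound₁ ℕ.+ bound₁)))

    module _ (𝓜 : Model m n) {ρ σ τ} (d : Digits 𝓜 {k} ρ σ τ) where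

      difference : ℕ → ℤ
      difference i = + value 𝓜 (evalT (S 𝓜) ρ t) i - + value 𝓜 (evalT (S 𝓜) ρ s) i

      expandDifference : Alm (U 𝓜) (λ i →
        + m * difference i ≡ + a 𝓜 i * (+ C 𝓜 i * ⟦ L₁ ⟧ σ i + ⟦ L₂ ⟧ τ i) + ⟦ L₃ ⟧ σ i)
      expandDifference = map₂ (U 𝓜) (λ i x y →
          ring (+ m) (+ n) (+ a 𝓜 i) (+ C 𝓜 i) (+ value 𝓜 (evalT (S 𝓜) ρ t) i)
            (⟦ pForm m t ⟧ σ i) (⟦ linear eVar t ⟧ τ i) (⟦ linear vVar t ⟧ σ i)
            (+ value 𝓜 (evalT (S 𝓜) ρ s) i)
            (⟦ pForm m s ⟧ σ i) (⟦ linear eVar s ⟧ τ i) (⟦ linear vVar s ⟧ σ i)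
            (Expansion.expand x) (Expansion.expand y))
          (expandTerm 𝓜 d t) (expandTerm 𝓜 d s)
        where
        ring : ∀ m n a C X P Q R X' P' Q' R' →
          m * X ≡ a * (C * P + m * Q) + n * R → m * X' ≡ a * (C * P' + m * Q') + n * R' →
          m * (X - X') ≡ a * (C * (P + -1ℤ * P') + m * (Q + -1ℤ * Q')) + n * (R + -1ℤ * R')
        ring m n a C X P Q R X' P' Q' R' e e' =
          trans (r₁ m X X') (trans (cong₂ _-_ e e') (r₂ m n a C P Q R P' Q' R'))
          where
          r₁ : ∀ m X X' → m * (X - X') ≡ m * X - m * X'
          r₁ = solve-∀
          r₂ : ∀ m n a C P Q R P' Q' R' → (a * (C * P + m * Q) + n * R) - (a * (C * P' + m * Q') + n * R') ≡
               a * (C * (P + -1ℤ * P') + m * (Q + -1ℤ * Q')) + n * (R + -1ℤ * R')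
          r₂ = solve-∀

      A≥1 : Alm (U 𝓜) (λ i → NN (⟦ aVar k ⟧ σ i - 1ℤ))
      A≥1 = map₁ (U 𝓜) (λ i p → subst (λ v → NN (v - 1ℤ)) (sym (⟦aVar⟧ 𝓜 d i)) (≤⇒NN p)) (a≥1 𝓜)

      Γ≥1 : Alm (U 𝓜) (λ i → NN (⟦ CVar k ⟧ τ i - 1ℤ))
      Γ≥1 = map₁ (U 𝓜) (λ i p → subst (λ v → NN (v - 1ℤ)) (sym (⟦CVar⟧ 𝓜 d i)) (≤⇒NN p)) (C≥1 𝓜)

      L₃-bounds : Alm (U 𝓜) (λ i → NN (⟦ L₃ ⟧ σ i + + bound₁ * ⟦ aVar k ⟧ σ i) ×
                                   NN (+ bound₁ * ⟦ aVar k ⟧ σ i - ⟦ L₃ ⟧ σ i))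
      L₃-bounds = map₂ (U 𝓜) (λ i x y → subst (λ v → NN (⟦ L₃ ⟧ σ i + + bound₁ * v) × NN (+ bound₁ * v - ⟦ L₃ ⟧ σ i))
          (sym (⟦aVar⟧ 𝓜 d i))
          (Within-difference n (size t) (size s) (a 𝓜 i) (⟦ linear vVar t ⟧ σ i) (⟦ linear vVar s ⟧ σ i)
            (Expansion.withinR x) (Expansion.withinR y)))
        (expandTerm 𝓜 d t) (expandTerm 𝓜 d s)

      L₂-bounds : ∀ j → j < suc (bound₁ ℕ.+ bound₁) → Alm (U 𝓜) (λ i →
          NN (⟦ L₂ ⊞ con (offset bound₁ j) ⟧ τ i + + bound₂ * ⟦ CVar k ⟧ τ i) ×
          NN (+ bound₂ * ⟦ CVar k ⟧ τ i - ⟦ L₂ ⊞ con (offset bound₁ j) ⟧ τ i))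
      L₂-bounds j j< = map₃ (U 𝓜) (λ i x y c → subst
          (λ v → NN (⟦ L₂ ⊞ con (offset bound₁ j) ⟧ τ i + + bound₂ * v) ×
                 NN (+ bound₂ * v - ⟦ L₂ ⊞ con (offset bound₁ j) ⟧ τ i))
          (sym (⟦CVar⟧ 𝓜 d i))
          (shifted (+ (m ℕ.* (size s ℕ.+ size t))) (+ bound₁) (+ C 𝓜 i) (⟦ L₂ ⟧ τ i) (+ j) (NN-ℕ {bound₁}) (NN-ℕ {j})
            (≤⇒NN (ℕP.≤-pred j<)) (≤⇒NN c)
            (Within-difference m (size t) (size s) (C 𝓜 i) (⟦ linear eVar t ⟧ τ i) (⟦ linear eVar s ⟧ τ i)
              (Expansion.withinQ x) (Expansion.withinQ y))))
        (expandTerm 𝓜 d t) (expandTerm 𝓜 d s) (C≥1 𝓜)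
        where
        shifted : ∀ M B A L j → NN B → NN j → NN (B + B - j) → NN (A - 1ℤ) →
                  NN (L + M * A) × NN (M * A - L) →
                  NN (L + (j - B) + (M + B) * A) × NN ((M + B) * A - (L + (j - B)))
        shifted M B A L j b j≥0 j≤ A≥1 (p , q) =
          subst NN (r₁ M B A L j) (NN-+ p (NN-+ j≥0 (NN-* b A≥1))) ,
          subst NN (r₂ M B A L j) (NN-+ q (NN-+ j≤ (NN-* b A≥1)))
          where
          r₁ : ∀ M B A L j → (L + M * A) + (j + B * (A - 1ℤ)) ≡ L + (j - B) + (M + B) * A
          r₁ = solve-∀
          r₂ : ∀ M B A L j → (M * A - L) + ((B + B - j) + B * (A - 1ℤ)) ≡ (M + B) * A - (L + (j - B))
          r₂ = solve-∀

      reduce : ∀ j l →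
        Alm (U 𝓜) (λ i → Floor (⟦ aVar k ⟧ σ i) (⟦ L₃ ⟧ σ i) bound₁ j) →
        Alm (U 𝓜) (λ i → Floor (⟦ CVar k ⟧ τ i) (⟦ L₂ ⊞ con (offset bound₁ j) ⟧ τ i) bound₂ l) →
        Alm (U 𝓜) (λ i → NN (difference i)) ⇔ Alm (U 𝓜) (λ i → NN (⟦ L₁ ⊞ con (offset bound₂ l) ⟧ σ i))
      reduce j l f g = Alm-⇔-on (U 𝓜) (map₃ (U 𝓜) (λ i e f g →
          two-floors {m} {a 𝓜 i} {C 𝓜 i} {difference i} {⟦ L₁ ⟧ σ i} {⟦ L₂ ⟧ τ i} {⟦ L₃ ⟧ σ i} {bound₁} {j} {bound₂} {l}
            1≤m e (subst (λ v → Floor v (⟦ L₃ ⟧ σ i) bound₁ j) (⟦aVar⟧ 𝓜 d i) f)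
                  (subst (λ v → Floor v (⟦ L₂ ⟧ τ i + offset bound₁ j) bound₂ l) (⟦CVar⟧ 𝓜 d i) g))
        expandDifference f g)

    module _ (𝓜 𝓜' : Model m n) {ρ σ τ ρ' σ' τ'} (d : Digits 𝓜 {k} ρ σ τ) (d' : Digits 𝓜' {k} ρ' σ' τ')
             (sgn₁ : ∀ {F} → F ∈ ≤-forms₁ → SameSign (U 𝓜) (U 𝓜') σ σ' F)
             (sgn₂ : ∀ {F} → F ∈ ≤-forms₂ → SameSign (U 𝓜) (U 𝓜') τ τ' F) where

      floors₁ : ∃[ j ] j < suc (bound₁ ℕ.+ bound₁) ×
                       Alm (U 𝓜)  (λ i → Floor (⟦ aVar k ⟧ σ  i) (⟦ L₃ ⟧ σ  i) bound₁ j) ×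
                       Alm (U 𝓜') (λ i → Floor (⟦ aVar k ⟧ σ' i) (⟦ L₃ ⟧ σ' i) bound₁ j)
      floors₁ = commonFloor (U 𝓜) (U 𝓜') σ σ' (aVar k) L₃ bound₁ (λ F∈ → sgn₁ (∈-++⁺ˡ F∈)) (A≥1 𝓜 d)
        (map₁ (U 𝓜) (λ _ → proj₁) (L₃-bounds 𝓜 d)) (map₁ (U 𝓜) (λ _ → proj₂) (L₃-bounds 𝓜 d))

      floors₂ : ∀ j → j < suc (bound₁ ℕ.+ bound₁) →
        ∃[ l ] l < suc (bound₂ ℕ.+ bound₂) ×
               Alm (U 𝓜)  (λ i → Floor (⟦ CVar k ⟧ τ  i) (⟦ L₂ ⊞ con (offset bound₁ j) ⟧ τ  i) bound₂ l) ×
               Alm (U 𝓜') (λ i → Floor (⟦ CVar k ⟧ τ' i) (⟦ L₂ ⊞ con (offset bound₁ j) ⟧ τ' i) bound₂ l)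
      floors₂ j j< = commonFloor (U 𝓜) (U 𝓜') τ τ' (CVar k) (L₂ ⊞ con (offset bound₁ j)) bound₂
        (λ F∈ → sgn₂ (∈-concatMap (λ j → floorForms (CVar k) (L₂ ⊞ con (offset bound₁ j)) bound₂) (∈-upTo⁺ j<) F∈))
        (Γ≥1 𝓜 d)
        (map₁ (U 𝓜) (λ _ → proj₁) (L₂-bounds 𝓜 d j j<)) (map₁ (U 𝓜) (λ _ → proj₂) (L₂-bounds 𝓜 d j j<))

      -- Both carries are standard and common to the two models; once they are known, each
      -- comparison is the sign of the same form in the variables of the first game.
      ≤-transfer : Alm (U 𝓜) (λ i → NN (difference 𝓜 d i)) ⇔ Alm (U 𝓜') (λ i → NN (difference 𝓜' d' i))
      ≤-transfer =
        let (j , j< , f , f') = floors₁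
            (l , l< , g , g') = floors₂ j j<
        in ⇔-trans (reduce 𝓜 d j l f g)
             (⇔-trans (sgn₁ (∈-++⁺ʳ (floorForms (aVar k) L₃ bound₁)
                               (∈-map⁺ (λ j → L₁ ⊞ con (offset bound₂ j)) (∈-upTo⁺ l<))))
               (⇔-sym (reduce 𝓜' d' j l f' g')))

-- Transfer of formulas

module Transfer (m n : ℕ) (1≤m : 1 ≤ m) where
  open Order m n 1≤m

  -- An implication suffices: the models are arbitrary, so exchanging them yields the converse, as
  -- the case of negation requires.
  Transfers : ∀ {k} → Formula k → Requirement (suc (twice k)) → Requirement (suc k) → Set₁
  Transfers {k} φ Q₁ Q₂ = ∀ (𝓜 𝓜' : Model m n) {ρ σ τ ρ' σ' τ'} →
    Digits 𝓜 {k} ρ σ τ → Digits 𝓜' {k} ρ' σ' τ' →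
    Agree (U 𝓜) (U 𝓜') Q₁ σ σ' → Agree (U 𝓜) (U 𝓜') Q₂ τ τ' →
    Sat (S 𝓜) ρ φ → Sat (S 𝓜') ρ' φ

  ≤-Q₁ : ∀ {k} → Term k → Term k → Requirement (suc (twice k))
  ≤-Q₁ s t = req (≤-forms₁ s t) 1 ℕP.≤-refl

  ≤-Q₂ : ∀ {k} → Term k → Term k → Requirement (suc k)
  ≤-Q₂ s t = req (≤-forms₂ s t) 1 ℕP.≤-refl

  -- The order is linear, so s < t is the negation of t ≤ s; this accounts for the exchanged
  -- arguments in the requirements.
  transfer-≺ : ∀ {k} (s t : Term k) → Transfers (s ≺ₜ t) (≤-Q₁ t s) (≤-Q₂ t s)
  transfer-≺ s t 𝓜 𝓜' d d' ag₁ ag₂ sat ¬s<t' = sat λ s<t → ¬s<t'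
    (map₁ (U 𝓜') (λ i ¬p → ℕP.≰⇒> (λ p → ¬p (≤⇒NN p)))
      (¬Alm⇒Alm¬ (U 𝓜') λ t≤s' → Alm-disjoint (U 𝓜) (λ i p q → ℕP.<⇒≱ p (NN⇒≤ q)) s<t
        (from (≤-transfer t s 𝓜 𝓜' d d' (signs ag₁) (signs ag₂)) t≤s')))

  transfer-≐ : ∀ {k} (s t : Term k) → Transfers (s ≐ t) (≤-Q₁ s t ∪ ≤-Q₁ t s) (≤-Q₂ s t ∪ ≤-Q₂ t s)
  transfer-≐ s t 𝓜 𝓜' {σ = σ} {τ} {σ' = σ'} {τ'} d d' ag₁ ag₂ sat ¬s≡t' = sat λ s≡t → ¬s≡t'
    (map₂ (U 𝓜') (λ i p q → ℕP.≤-antisym (NN⇒≤ p) (NN⇒≤ q))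
      (to (≤-transfer s t 𝓜 𝓜' d d'
            (signs (Agree-∪ˡ {Q = ≤-Q₁ s t} {≤-Q₁ t s} {σ} {σ'} ag₁))
            (signs (Agree-∪ˡ {Q = ≤-Q₂ s t} {≤-Q₂ t s} {τ} {τ'} ag₂)))
          (map₁ (U 𝓜) (λ i e → ≤⇒NN (ℕP.≤-reflexive e)) s≡t))
      (to (≤-transfer t s 𝓜 𝓜' d d'
            (signs (Agree-∪ʳ {Q = ≤-Q₁ s t} {≤-Q₁ t s} {σ} {σ'} ag₁))
            (signs (Agree-∪ʳ {Q = ≤-Q₂ s t} {≤-Q₂ t s} {τ} {τ'} ag₂)))
          (map₁ (U 𝓜) (λ i e → ≤⇒NN (ℕP.≤-reflexive (sym e))) s≡t)))

  -- Added to a requirement so that the reply to a digit v or e is again a digit, that is, below a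
  -- or C.
  below : ∀ {k} → Lin k → Lin k → Requirement k
  below x A = req [ (A ⊟ x) ⊞ con -1ℤ ] 1 ℕP.≤-refl

  below-transfer : ∀ V V' {k} {ρ ρ' : Env k} {X A} → Agree V V' (below X A) ρ ρ' →
    ∀ {x c x' c' : ℕ → ℕ} → (∀ i → ⟦ X ⟧ ρ i ≡ + x i) → (∀ i → ⟦ A ⟧ ρ i ≡ + c i) →
    (∀ i → ⟦ X ⟧ ρ' i ≡ + x' i) → (∀ i → ⟦ A ⟧ ρ' i ≡ + c' i) →
    Alm V (λ i → x i < c i) → Alm V' (λ i → x' i < c' i)
  below-transfer V V' ag {x} {c} {x'} {c'} ex ec ex' ec' p =
    map₁ V' (λ i q → NN⇒< (subst NN
        (trans (cong₂ (λ u v → (v + -1ℤ * u) + -1ℤ) (ex' i) (ec' i)) (ring (+ x' i) (+ c' i))) q))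
      (to (signs ag (here refl)) (map₁ V (λ i q →
        subst NN (sym (trans (cong₂ (λ u v → (v + -1ℤ * u) + -1ℤ) (ex i) (ec i)) (ring (+ x i) (+ c i)))) (<⇒NN q)) p))
    where
    ring : ∀ x c → (c + -1ℤ * x) + -1ℤ ≡ c - x - 1ℤ
    ring = solve-∀

  module _ (𝓜 : Model m n) (x : Structure.Carrier (S 𝓜)) where

    private
      u w : ℕ → ℕ
      u i = proj₁ (proj₂ x i)
      w i = proj₁ (proj₂ (proj₂ x i))

    -- For u a + w b, write w = q a + v and move q a b into the multiples of a; their new
    -- coefficient u + q b is then divided by C, with quotient p and remainder e.
    vDigit pDigit eDigit : ℕ → ℕ
    vDigit i = proj₁ (proj₂ (euclid (w i) (a 𝓜 i)))

    quotient : ℕ → ℕ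
    quotient i = u i ℕ.+ proj₁ (euclid (w i) (a 𝓜 i)) ℕ.* b 𝓜 i

    pDigit i = proj₁ (euclid (quotient i) (C 𝓜 i))
    eDigit i = proj₁ (proj₂ (euclid (quotient i) (C 𝓜 i)))

    digits : ∀ {k ρ σ τ} → Digits 𝓜 {k} ρ σ τ → Digits 𝓜 (x ∷ ρ) (vDigit ∷ pDigit ∷ σ) (eDigit ∷ τ)
    digits d = add d (map₂ (U 𝓜) represent (a≥1 𝓜) (C≥1 𝓜))
                     (map₁ (U 𝓜) (λ i p → proj₂ (proj₂ (proj₂ (euclid (w i) (a 𝓜 i))) p)) (a≥1 𝓜))
                     (map₁ (U 𝓜) (λ i p → proj₂ (proj₂ (proj₂ (euclid (quotient i) (C 𝓜 i))) p)) (C≥1 𝓜))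
      where
      ring : ∀ u q a v b → u ℕ.* a ℕ.+ (q ℕ.* a ℕ.+ v) ℕ.* b ≡ (u ℕ.+ q ℕ.* b) ℕ.* a ℕ.+ v ℕ.* b
      ring = ℕSolver.solve-∀
      represent : ∀ i → 1 ≤ a 𝓜 i → 1 ≤ C 𝓜 i →
                  value 𝓜 x i ≡ (pDigit i ℕ.* C 𝓜 i ℕ.+ eDigit i) ℕ.* a 𝓜 i ℕ.+ vDigit i ℕ.* b 𝓜 i
      represent i 1≤a 1≤C =
        trans (proj₂ (proj₂ (proj₂ x i)))
          (trans (cong (λ z → u i ℕ.* a 𝓜 i ℕ.+ z ℕ.* b 𝓜 i) (proj₁ (proj₂ (proj₂ (euclid (w i) (a 𝓜 i))) 1≤a)))
            (trans (ring (u i) (proj₁ (euclid (w i) (a 𝓜 i))) (a 𝓜 i) (vDigit i) (b 𝓜 i))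
              (cong (λ z → z ℕ.* a 𝓜 i ℕ.+ vDigit i ℕ.* b 𝓜 i)
                (proj₁ (proj₂ (proj₂ (euclid (quotient i) (C 𝓜 i))) 1≤C)))))

  fromDigits : (𝓜 : Model m n) (v p e : ℕ → ℕ) → Structure.Carrier (S 𝓜)
  fromDigits 𝓜 v p e = (λ i → (p i ℕ.* C 𝓜 i ℕ.+ e i) ℕ.* a 𝓜 i ℕ.+ v i ℕ.* b 𝓜 i) ,
                       (λ i → p i ℕ.* C 𝓜 i ℕ.+ e i , v i , refl)

  module _ {k : ℕ} (φ : Formula (suc k)) (Q₁ : Requirement (suc (twice (suc k)))) (Q₂ : Requirement (suc (suc k))) where

    R₁ : Requirement (suc (twice (suc k)))
    R₁ = below top (aVar (suc k))

    R₂ : Requirement (suc (suc k))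
    R₂ = below top (CVar (suc k))

    pv-Q : Σ[ Q ∈ Requirement (suc (suc (twice k))) ] Extends Q (Q₁ ∪ R₁)
    pv-Q = extend (Q₁ ∪ R₁)

    p-Q : Σ[ Q ∈ Requirement (suc (twice k)) ] Extends Q (proj₁ pv-Q)
    p-Q = extend (proj₁ pv-Q)

    e-Q : Σ[ Q ∈ Requirement (suc k) ] Extends Q (Q₂ ∪ R₂)
    e-Q = extend (Q₂ ∪ R₂)

    -- The challenge is an element of the second model. Its digits p and v are answered by two
    -- successive moves in the game for a, its digit e by one move in the game for C, and the
    -- replies are assembled into an element of the first model.
    transfer-∀ : Transfers φ Q₁ Q₂ → Transfers (∀ᶠ φ) (proj₁ p-Q) (proj₁ e-Q)
    transfer-∀ ih 𝓜 𝓜' {ρ} {σ} {τ} {ρ'} {σ'} {τ'} d d' ag₁ ag₂ sat x' =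
      let v' = vDigit 𝓜' x'
          p' = pDigit 𝓜' x'
          e' = eDigit 𝓜' x'
          (p , agp) = proj₂ p-Q {U 𝓜'} {U 𝓜} {σ'} {σ} (Agree-sym {U 𝓜} {U 𝓜'} {ρ = σ} {σ'} ag₁) p'
          (v , agv) = proj₂ pv-Q {U 𝓜'} {U 𝓜} {p' ∷ σ'} {p ∷ σ} agp v'
          (e , age) = proj₂ e-Q {U 𝓜'} {U 𝓜} {τ'} {τ} (Agree-sym {U 𝓜} {U 𝓜'} {ρ = τ} {τ'} ag₂) e'
      in finish x' v p e agv age
      where
      finish : ∀ x' v p e →
        Agree (U 𝓜') (U 𝓜) (Q₁ ∪ R₁) (vDigit 𝓜' x' ∷ pDigit 𝓜' x' ∷ σ') (v ∷ p ∷ σ) →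
        Agree (U 𝓜') (U 𝓜) (Q₂ ∪ R₂) (eDigit 𝓜' x' ∷ τ') (e ∷ τ) → Sat (S 𝓜') (x' ∷ ρ') φ
      finish x' v p e agv age with digits 𝓜' x' d'
      ... | D'@(add _ _ v<a' e<C') =
        ih 𝓜 𝓜' {fromDigits 𝓜 v p e ∷ ρ} {v ∷ p ∷ σ} {e ∷ τ} {x' ∷ ρ'} {vDigit 𝓜' x' ∷ pDigit 𝓜' x' ∷ σ'} {eDigit 𝓜' x' ∷ τ'}
          (add d (always (U 𝓜) (λ i → refl))
            (below-transfer (U 𝓜') (U 𝓜) (Agree-∪ʳ {Q = Q₁} {R = R₁} agv)
              (λ i → refl) (⟦aVar⟧ 𝓜' d') (λ i → refl) (⟦aVar⟧ 𝓜 d) v<a')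
            (below-transfer (U 𝓜') (U 𝓜) (Agree-∪ʳ {Q = Q₂} {R = R₂} age)
              (λ i → refl) (⟦CVar⟧ 𝓜' d') (λ i → refl) (⟦CVar⟧ 𝓜 d) e<C'))
          D'
          (Agree-sym {U 𝓜'} {U 𝓜} (Agree-∪ˡ {Q = Q₁} {R = R₁} agv))
          (Agree-sym {U 𝓜'} {U 𝓜} (Agree-∪ˡ {Q = Q₂} {R = R₂} age))
          (sat (fromDigits 𝓜 v p e))

  transfer : ∀ {k} (φ : Formula k) → ∃[ Q₁ ] ∃[ Q₂ ] Transfers φ Q₁ Q₂
  transfer (s ≐ t)  = _ , _ , transfer-≐ s t
  transfer (s ≺ₜ t) = _ , _ , transfer-≺ s t
  transfer (¬ᶠ φ)   =
    let (Q₁ , Q₂ , ih) = transfer φ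
    in Q₁ , Q₂ , λ 𝓜 𝓜' {σ = σ} {τ} {σ' = σ'} {τ'} d d' ag₁ ag₂ ¬sat sat' →
         ¬sat (ih 𝓜' 𝓜 d' d (Agree-sym {U 𝓜} {U 𝓜'} {ρ = σ} {σ'} ag₁) (Agree-sym {U 𝓜} {U 𝓜'} {ρ = τ} {τ'} ag₂) sat')
  transfer (φ ∧ᶠ ψ) =
    let (Q₁ , Q₂ , ih)  = transfer φ
        (R₁ , R₂ , ih') = transfer ψ
    in Q₁ ∪ R₁ , Q₂ ∪ R₂ , λ 𝓜 𝓜' d d' ag₁ ag₂ (sat , sat') →
         ih  𝓜 𝓜' d d' (Agree-∪ˡ {Q = Q₁} {R = R₁} ag₁) (Agree-∪ˡ {Q = Q₂} {R = R₂} ag₂) sat ,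
         ih' 𝓜 𝓜' d d' (Agree-∪ʳ {Q = Q₁} {R = R₁} ag₁) (Agree-∪ʳ {Q = Q₂} {R = R₂} ag₂) sat'
  transfer (∀ᶠ φ)   =
    let (Q₁ , Q₂ , ih) = transfer φ
    in proj₁ (p-Q φ Q₁ Q₂) , proj₁ (e-Q φ Q₁ Q₂) , transfer-∀ φ Q₁ Q₂ ih

-- The initial position

⟦⟧-closed : ∀ (L : Lin 0) i j → ⟦ L ⟧ [] i ≡ ⟦ L ⟧ [] j
⟦⟧-closed (con d) i j = refl
⟦⟧-closed (s ⊞ t) i j = cong₂ _+_ (⟦⟧-closed s i j) (⟦⟧-closed t i j)
⟦⟧-closed (c ⊡ t) i j = cong (c *_) (⟦⟧-closed t i j)

⟦⟧-single : ∀ (F : Lin 1) x i → ⟦ F ⟧ (x ∷ []) i ≡ coef F * + x i + ⟦ rest F ⟧ [] 0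
⟦⟧-single F x i = trans (⟦⟧-split F x [] i) (cong (λ z → coef F * + x i + z) (⟦⟧-closed (rest F) i 0))

Eventually : (ℕ → Set) → Set
Eventually P = ∃[ B ] ∀ x → B ≤ x → P x

+∣d∣ : ∀ d → NN (d + + ∣ d ∣)
+∣d∣ (+ d)    = NN-ℕ
+∣d∣ -[1+ d ] = subst NN (sym (ℤP.+-inverseˡ (+ suc d))) NN-ℕ

-∣d∣ : ∀ d → NN (+ ∣ d ∣ - d)
-∣d∣ (+ d)    = subst NN (sym (ℤP.+-inverseʳ (+ d))) NN-ℕ
-∣d∣ -[1+ d ] = NN-ℕ

-- Once x exceeds the absolute value of d, a nonzero c decides the sign; for c = 0 the constant d
-- does.
eventual-sign : ∀ c d → Eventually (λ x → NN (c * + x + d)) ⊎ Eventually (λ x → ¬ NN (c * + x + d))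
eventual-sign (+ zero) d with 0ℤ ℤ.≤? d
... | yes p = inj₁ (0 , λ x _ → subst NN (sym (ring (+ x) d)) p)
  where
  ring : ∀ x d → 0ℤ * x + d ≡ d
  ring = solve-∀
... | no ¬p = inj₂ (0 , λ x _ p → ¬p (subst NN (ring (+ x) d) p))
  where
  ring : ∀ x d → 0ℤ * x + d ≡ d
  ring = solve-∀
eventual-sign (+ suc c) d = inj₁ (∣ d ∣ , λ x d≤x →
  subst NN (ring (+ c) (+ x) d (+ ∣ d ∣)) (NN-+ (≤⇒NN d≤x) (NN-+ (NN-* (NN-ℕ {c}) (NN-ℕ {x})) (+∣d∣ d))))
  where
  ring : ∀ c x d e → (x - e) + (c * x + (d + e)) ≡ (1ℤ + c) * x + d
  ring = solve-∀
eventual-sign -[1+ c ] d = inj₂ (suc ∣ d ∣ , λ x d<x → NN⇒¬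
  (subst NN (ring (+ c) (+ x) d (+ ∣ d ∣)) (NN-+ (<⇒NN d<x) (NN-+ (NN-* (NN-ℕ {c}) (NN-ℕ {x})) (-∣d∣ d)))))
  where
  ring : ∀ c x d e → (x - e - 1ℤ) + (c * x + (e - d)) ≡ -1ℤ - (- (1ℤ + c) * x + d)
  ring = solve-∀

Unbounded : Ultrafilter → (ℕ → ℕ) → Set
Unbounded U x = ∀ B → Alm U (λ i → B ≤ x i)

module _ (U U' : Ultrafilter) {x x' : ℕ → ℕ} where

  -- A linear form in one infinite variable has its eventual sign on both sides, so only the
  -- residues have to be matched.
  agree-unbounded : Unbounded U x → Unbounded U' x' → ∀ Q →
    CommonResidue U U' (modulus Q) (λ i → + x i) (λ i → + x' i) → Agree U U' Q (x ∷ []) (x' ∷ [])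
  agree-unbounded ∞ ∞' Q common = agree (λ {F} _ → sgn F) (common , tt)
    where
    sgn : ∀ F → SameSign U U' (x ∷ []) (x' ∷ []) F
    sgn F with eventual-sign (coef F) (⟦ rest F ⟧ [] 0)
    ... | inj₁ (B , h) = mk⇔ (λ _ → map₁ U' (λ i p → subst NN (sym (⟦⟧-single F x' i)) (h (x' i) p)) (∞' B))
                             (λ _ → map₁ U (λ i p → subst NN (sym (⟦⟧-single F x i)) (h (x i) p)) (∞ B))
    ... | inj₂ (B , h) = mk⇔
      (λ q → ⊥-elim (Alm-disjoint U (λ i p r → h (x i) p (subst NN (⟦⟧-single F x i) r)) (∞ B) q))
      (λ q → ⊥-elim (Alm-disjoint U' (λ i p r → h (x' i) p (subst NN (⟦⟧-single F x' i) r)) (∞' B) q))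

  agree-constant : ∀ γ → Alm U (λ i → x i ≡ γ) → Alm U' (λ i → x' i ≡ γ) → ∀ Q →
    Agree U U' Q (x ∷ []) (x' ∷ [])
  agree-constant γ p p' Q =
    agree (λ {F} _ → ⇔-trans (standard U p F) (⇔-sym (standard U' p' F)))
          ((+ γ , map₁ U (λ i → residue) p , map₁ U' (λ i → residue) p') , tt)
    where
    residue : ∀ {y} → y ≡ γ → Congruent (modulus Q) (+ y) (+ γ)
    residue refl = Congruent-refl (modulus Q) (+ γ)
    standard : ∀ V {y} → Alm V (λ i → y i ≡ γ) → ∀ F →
               Alm V (λ i → NN (⟦ F ⟧ (y ∷ []) i)) ⇔ NN (coef F * + γ + ⟦ rest F ⟧ [] 0)
    standard V {y} q F = mk⇔
      (λ r → Alm-dec V (0ℤ ℤ.≤? _) (map₂ V (λ i e → subst NN (atγ e)) q r))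
      (λ r → map₁ V (λ i e → subst NN (sym (atγ e)) r) q)
      where
      atγ : ∀ {i} → y i ≡ γ → ⟦ F ⟧ (y ∷ []) i ≡ coef F * + γ + ⟦ rest F ⟧ [] 0
      atγ {i} e = trans (⟦⟧-single F y i) (cong (λ z → coef F * + z + ⟦ rest F ⟧ [] 0) e)

%⇒Congruent : ∀ k x r → x % suc k ≡ r → Congruent (suc k) (+ x) (+ r)
%⇒Congruent k x r refl = divides (+ (x / suc k))
  (trans (cong (λ z → + z - + (x % suc k)) (m≡m%n+[m/n]*n x (suc k)))
    (trans (ring (+ (x % suc k)) (+ (x / suc k ℕ.* suc k))) (ℤP.pos-* (x / suc k) (suc k))))
  where
  ring : ∀ r q → (r + q) - r ≡ q
  ring = solve-∀

commonResidue : ∀ U U' (f f' : ℕ → ℕ) →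
  (∀ k r → r < suc k → Alm U (λ i → f i % suc k ≡ r) ⇔ Alm U' (λ i → f' i % suc k ≡ r)) →
  ∀ M → 1 ≤ M → CommonResidue U U' M (λ i → + f i) (λ i → + f' i)
commonResidue U U' f f' same (suc k) _ =
  let (r , r<M , p) = bounded⇒constant U (λ i → f i % suc k) (suc k) (always U (λ i → m%n<n (f i) (suc k)))
  in + r , map₁ U (λ i → %⇒Congruent k (f i) r) p
         , map₁ U' (λ i → %⇒Congruent k (f' i) r) (to (same k r r<M) p)

-- Atoms are read under a double negation, and the connectives preserve stability; a proof of
-- satisfaction may thus use facts known only up to double negation.
Sat-stable : ∀ M {k} (ρ : Vec (Structure.Carrier M) k) φ → ¬ ¬ Sat M ρ φ → Sat M ρ φ
Sat-stable M ρ (s ≐ t)  ¬¬p ¬q = ¬¬p (λ p → p ¬q)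
Sat-stable M ρ (s ≺ₜ t) ¬¬p ¬q = ¬¬p (λ p → p ¬q)
Sat-stable M ρ (¬ᶠ φ)   ¬¬p q  = ¬¬p (λ p → p q)
Sat-stable M ρ (φ ∧ᶠ ψ) ¬¬p    = Sat-stable M ρ φ (λ ¬p → ¬¬p (λ (p , _) → ¬p p)) ,
                                 Sat-stable M ρ ψ (λ ¬q → ¬¬p (λ (_ , q) → ¬q q))
Sat-stable M ρ (∀ᶠ φ)   ¬¬p x  = Sat-stable M (x ∷ ρ) φ (λ ¬p → ¬¬p (λ p → ¬p (p x)))

floor-spec : ∀ b a → 1 ≤ a → ∃[ d ] d < a × b ≡ ⌊ b / a ⌋ ℕ.* a ℕ.+ d
floor-spec b (suc a) _ = b % suc a , m%n<n b (suc a) , trans (m≡m%n+[m/n]*n b (suc a)) (ℕP.+-comm (b % suc a) _)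

-- The cofactor of an admissible pair

module _ {m n : ℕ} (1≤m : 1 ≤ m) {a b : ℕ → ℕ} {U : Ultrafilter} (adm : Admissible m n a b U) where

  open Admissible adm

  a-unbounded : Unbounded U a
  a-unbounded B = let (N , h) = a→∞ B in map₁ U h (nonPrincipal N)

  gcd[m,a]≡1 : Alm U (λ i → gcd m (a i) ≡ 1)
  gcd[m,a]≡1 = let (N , h) = gcd-m-a in
    map₁ U (λ i N≤i → decidable-stable (gcd m (a i) ℕ.≟ 1) (λ ¬p → ℕP.<⇒≱ (h i ¬p) N≤i))
      (nonPrincipal N)

  cofactor : ℕ → ℤ
  cofactor i = _∣_.quotient (∣ᵤ⇒∣ {+ a i} {+ (m ℕ.* b i) - + n} (congr i))

  cofactorℕ : ℕ → ℕ
  cofactorℕ i = ∣ cofactor i ∣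

  cofactor-equation : ∀ i → + (m ℕ.* b i) - + n ≡ cofactor i * + a i
  cofactor-equation i = _∣_.equality (∣ᵤ⇒∣ {+ a i} {+ (m ℕ.* b i) - + n} (congr i))

  positive-factor : ∀ q a → NN (q * + a - 1ℤ) → ∃[ c ] q ≡ + suc c
  positive-factor (+ suc c)  a       p = c , refl
  positive-factor (+ zero)   a       ()
  positive-factor -[1+ c ]   zero    p = ⊥-elim (absurd (subst (λ z → NN (z - 1ℤ)) (ℤP.*-zeroʳ -[1+ c ]) p))
    where
    absurd : ¬ NN (0ℤ - 1ℤ)
    absurd ()
  positive-factor -[1+ c ]   (suc a) ()

  b≤mb : ∀ i → b i ≤ m ℕ.* b i
  b≤mb i = subst (ℕ._≤ m ℕ.* b i) (ℕP.*-identityˡ (b i)) (ℕP.*-monoˡ-≤ (b i) 1≤m)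

  -- n < a < b ≤ m b, so m b - n is a positive multiple of a.
  cofactor-positive : ∀ i → n < a i → ∃[ c ] cofactor i ≡ + suc c
  cofactor-positive i n<a = positive-factor (cofactor i) (a i)
    (subst (λ z → NN (z - 1ℤ)) (cofactor-equation i)
      (<⇒NN (ℕP.<-≤-trans n<a (ℕP.≤-trans (ℕP.<⇒≤ (a<b i)) (b≤mb i)))))

  cofactorℕ-relation : ∀ i → n < a i → m ℕ.* b i ≡ a i ℕ.* cofactorℕ i ℕ.+ n
  cofactorℕ-relation i n<a = let (c , eq) = cofactor-positive i n<a in
    trans (ℤP.+-injective (trans (ring (+ (m ℕ.* b i)) (+ n))
        (cong (_+ + n) (trans (cofactor-equation i)
          (trans (cong (_* + a i) (trans eq (cong (λ z → + ∣ z ∣) (sym eq))))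
                 (sym (ℤP.pos-* (cofactorℕ i) (a i))))))))
      (cong (ℕ._+ n) (ℕP.*-comm (cofactorℕ i) (a i)))
    where
    ring : ∀ x n → x ≡ (x - n) + n
    ring = solve-∀

  model : Model m n
  model = record
    { U        = U
    ; a        = a
    ; b        = b
    ; C        = cofactorℕ
    ; a≥1      = a-unbounded 1
    ; C≥1      = map₁ U (λ i n<a → let (c , eq) = cofactor-positive i n<a in
                   subst (λ z → 1 ≤ ∣ z ∣) (sym eq) (ℕ.s≤s ℕ.z≤n)) (a-unbounded (suc n))
    ; relation = map₁ U cofactorℕ-relation (a-unbounded (suc n))
    }

module _ {m n a b C : ℕ} (1≤m : 1 ≤ m) (n<a : n < a) (rel : m ℕ.* b ≡ a ℕ.* C ℕ.+ n) where

  private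
    c d : ℕ
    c = ⌊ b / a ⌋
    d = proj₁ (floor-spec b a (ℕP.≤-trans (ℕ.s≤s ℕ.z≤n) n<a))

    d<a : d < a
    d<a = proj₁ (proj₂ (floor-spec b a (ℕP.≤-trans (ℕ.s≤s ℕ.z≤n) n<a)))

    aC+n : a ℕ.* C ℕ.+ n ≡ a ℕ.* (m ℕ.* c) ℕ.+ m ℕ.* d
    aC+n = trans (sym rel) (trans (cong (m ℕ.*_) (proj₂ (proj₂ (floor-spec b a (ℕP.≤-trans (ℕ.s≤s ℕ.z≤n) n<a)))))
             (ring m a c d))
      where
      ring : ∀ m a c d → m ℕ.* (c ℕ.* a ℕ.+ d) ≡ a ℕ.* (m ℕ.* c) ℕ.+ m ℕ.* d
      ring = ℕSolver.solve-∀

    -- Otherwise a (C + 1) ≤ a m c ≤ a C + n, against n < a.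
    mc≤C : m ℕ.* c ≤ C
    mc≤C = ℕP.≮⇒≥ λ C<mc → ℕP.<⇒≱ n<a (ℕP.+-cancelˡ-≤ (a ℕ.* C) a n (begin
      a ℕ.* C ℕ.+ a                   ≡⟨ ℕP.+-comm (a ℕ.* C) a ⟩
      a ℕ.+ a ℕ.* C                   ≡⟨ ℕP.*-suc a C ⟨
      a ℕ.* suc C                     ≤⟨ ℕP.*-monoʳ-≤ a C<mc ⟩
      a ℕ.* (m ℕ.* c)                 ≤⟨ ℕP.m≤m+n _ (m ℕ.* d) ⟩
      a ℕ.* (m ℕ.* c) ℕ.+ m ℕ.* d     ≡⟨ aC+n ⟨
      a ℕ.* C ℕ.+ n                   ∎))
      where open ℕP.≤-Reasoning

  cofactor-split : C ≡ m ℕ.* c ℕ.+ (C ℕ.∸ m ℕ.* c)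
  cofactor-split = sym (ℕP.m+[n∸m]≡n mc≤C)

  remainder-equation : a ℕ.* (C ℕ.∸ m ℕ.* c) ℕ.+ n ≡ m ℕ.* d
  remainder-equation = ℕP.+-cancelˡ-≡ (a ℕ.* (m ℕ.* c)) _ _
    (trans (ring a (m ℕ.* c) (C ℕ.∸ m ℕ.* c) n) (trans (cong (λ z → a ℕ.* z ℕ.+ n) (sym cofactor-split)) aC+n))
    where
    ring : ∀ a x s n → a ℕ.* x ℕ.+ (a ℕ.* s ℕ.+ n) ≡ a ℕ.* (x ℕ.+ s) ℕ.+ n
    ring = ℕSolver.solve-∀

  -- With s = C - m c and d the remainder of b modulo a, one has a s ≤ a s + n = m d < m a.
  remainder-bound : C ℕ.∸ m ℕ.* c < m
  remainder-bound = ℕP.≰⇒> λ m≤s → ℕP.<-irrefl refl (begin-strict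
    m ℕ.* d                          <⟨ ℕP.*-monoʳ-< m {{ℕ.>-nonZero 1≤m}} d<a ⟩
    m ℕ.* a                          ≡⟨ ℕP.*-comm m a ⟩
    a ℕ.* m                          ≤⟨ ℕP.*-monoʳ-≤ a m≤s ⟩
    a ℕ.* (C ℕ.∸ m ℕ.* c)            ≤⟨ ℕP.m≤m+n _ n ⟩
    a ℕ.* (C ℕ.∸ m ℕ.* c) ℕ.+ n      ≡⟨ remainder-equation ⟩
    m ℕ.* d                          ∎)
    where open ℕP.≤-Reasoning

  remainder-congruent : ∀ {s} → C ℕ.∸ m ℕ.* c ≡ s → Congruent m (+ s * + a) (- (+ n))
  remainder-congruent refl = divides (+ d)
    (trans (ring (+ (C ℕ.∸ m ℕ.* c) * + a) (+ n))
      (trans (cong (_+ + n) (trans (sym (ℤP.pos-* (C ℕ.∸ m ℕ.* c) a)) (cong +_ (ℕP.*-comm (C ℕ.∸ m ℕ.* c) a))))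
        (trans (cong +_ (trans remainder-equation (ℕP.*-comm m d))) (ℤP.pos-* d m))))
    where
    ring : ∀ x n → x - - n ≡ x + n
    ring = solve-∀

-- The absolute value of r - s is at most the maximum of r and s, hence below m; a multiple of m
-- that small is 0.
residue-unique : ∀ {m r s} → r < m → s < m → + m ∣ (+ r - + s) → r ≡ s
residue-unique {m} {r} {s} r<m s<m m∣ with ∣ + r - + s ∣ in eq
... | zero  = ℤP.+-injective (ℤP.i-j≡0⇒i≡j (+ r) (+ s) (ℤP.∣i∣≡0⇒i≡0 eq))
... | suc t = ⊥-elim (ℕD.>⇒∤ (ℕP.≤-<-trans small (ℕP.⊔-lub r<m s<m)) (subst (m ℕD.∣_) eq (∣⇒∣ᵤ m∣)))
  where
  small : suc t ≤ r ℕ.⊔ s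
  small = subst (ℕ._≤ r ℕ.⊔ s) (trans (cong ∣_∣ (sym (ℤP.m-n≡m⊖n r s))) eq) (ℤP.∣m⊝n∣≤m⊔n r s)

-- q₀ = m / γ when C is almost everywhere γ, because m b = a γ + n and a is infinite.
module _ {m n : ℕ} (1≤m : 1 ≤ m) where

  module _ {a b U} (adm : Admissible m n a b U) where

    -- From p b ≤ q a with p ≥ 1 follows a C ≤ m b ≤ m q a, so C ≤ m q, and a bounded function is
    -- constant almost everywhere.
    C-bounded : BelowQ0 a b U 0 1 → ∃[ γ ] Alm U (λ i → cofactorℕ 1≤m adm i ≡ γ)
    C-bounded (p , q , _ , p>0 , pb≤qa) =
      let (γ , _ , eq) = bounded⇒constant U (cofactorℕ 1≤m adm) (suc (m ℕ.* q))
            (map₂ U (λ i n<a h → ℕ.s≤s (bound i n<a h)) (a-unbounded 1≤m adm (suc n)) pb≤qa)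
      in γ , eq
      where
      bound : ∀ i → n < a i → p ℕ.* b i ≤ q ℕ.* a i → cofactorℕ 1≤m adm i ≤ m ℕ.* q
      bound i n<a h = ℕP.*-cancelˡ-≤ (a i) {{ℕ.>-nonZero (ℕP.≤-trans (ℕ.s≤s ℕ.z≤n) n<a)}} (begin
        a i ℕ.* cofactorℕ 1≤m adm i           ≤⟨ ℕP.m≤m+n _ n ⟩
        a i ℕ.* cofactorℕ 1≤m adm i ℕ.+ n     ≡⟨ cofactorℕ-relation 1≤m adm i n<a ⟨
        m ℕ.* b i                      ≡⟨ cong (m ℕ.*_) (ℕP.*-identityˡ (b i)) ⟨
        m ℕ.* (1 ℕ.* b i)              ≤⟨ ℕP.*-monoʳ-≤ m (ℕP.*-monoˡ-≤ (b i) (subst (1 ℕ.≤_) (ℕP.*-identityʳ p) p>0)) ⟩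
        m ℕ.* (p ℕ.* b i)              ≤⟨ ℕP.*-monoʳ-≤ m h ⟩
        m ℕ.* (q ℕ.* a i)              ≡⟨ ring m q (a i) ⟩
        a i ℕ.* (m ℕ.* q)              ∎)
        where
        open ℕP.≤-Reasoning
        ring : ∀ m q a → m ℕ.* (q ℕ.* a) ≡ a ℕ.* (m ℕ.* q)
        ring = ℕSolver.solve-∀

    C-unbounded : Q0IsZero a b U → Unbounded U (cofactorℕ 1≤m adm)
    C-unbounded q₀≡0 B with Alm? U (λ i → B ≤ cofactorℕ 1≤m adm i)
    ... | yes p = p
    -- If C < B, then b ≤ m b = a C + n ≤ (B + n + 1) a, which puts the positive rational 1 / (B + n
    -- + 1) into the set with supremum q₀.
    ... | no ¬p = ⊥-elim (q₀≡0 (1 , suc (B ℕ.+ n) , ℕ.s≤s ℕ.z≤n , ℕ.s≤s ℕ.z≤n ,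
          map₂ U bound (a-unbounded 1≤m adm (suc n)) (¬Alm⇒Alm¬ U ¬p)))
      where
      bound : ∀ i → n < a i → ¬ (B ≤ cofactorℕ 1≤m adm i) → 1 ℕ.* b i ≤ suc (B ℕ.+ n) ℕ.* a i
      bound i n<a B≰C = begin
        1 ℕ.* b i                             ≡⟨ ℕP.*-identityˡ (b i) ⟩
        b i                                   ≤⟨ b≤mb 1≤m adm i ⟩
        m ℕ.* b i                             ≡⟨ cofactorℕ-relation 1≤m adm i n<a ⟩
        a i ℕ.* cofactorℕ 1≤m adm i ℕ.+ n            ≤⟨ ℕP.+-mono-≤ (ℕP.*-monoʳ-≤ (a i) (ℕP.<⇒≤ (ℕP.≰⇒> B≰C))) (ℕP.<⇒≤ n<a) ⟩
        a i ℕ.* B ℕ.+ a i                     ≤⟨ ℕP.m≤m+n _ (a i ℕ.* n) ⟩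
        a i ℕ.* B ℕ.+ a i ℕ.+ a i ℕ.* n       ≡⟨ ring (a i) B n ⟩
        suc (B ℕ.+ n) ℕ.* a i                 ∎
        where
        open ℕP.≤-Reasoning
        ring : ∀ a B n → a ℕ.* B ℕ.+ a ℕ.+ a ℕ.* n ≡ suc (B ℕ.+ n) ℕ.* a
        ring = ℕSolver.solve-∀

    BelowQ0-intro : ∀ {γ γ'} → Alm U (λ i → cofactorℕ 1≤m adm i ≡ γ) → γ < γ' → BelowQ0 a b U m γ'
    BelowQ0-intro {γ} {γ'} C≡γ γ<γ' =
      -- The mediant 2 m / (γ + γ') of m / γ and m / γ' exceeds m / γ'. It belongs to the set with
      -- supremum q₀ because 2 m b = 2 a γ + 2 n ≤ a (2 γ + 1) once 2 n ≤ a.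
      m ℕ.+ m , γ ℕ.+ γ' , ℕP.≤-trans (ℕP.≤-trans (ℕ.s≤s ℕ.z≤n) γ<γ') (ℕP.m≤n+m γ' γ) ,
      subst₂ ℕ._<_ (sym (ℕP.*-distribˡ-+ m γ γ')) (sym (ℕP.*-distribʳ-+ γ' m m))
        (ℕP.+-monoˡ-< (m ℕ.* γ') (ℕP.*-monoʳ-< m {{ℕ.>-nonZero 1≤m}} γ<γ')) ,
      map₃ U bound (a-unbounded 1≤m adm (suc n)) (a-unbounded 1≤m adm (n ℕ.+ n)) C≡γ
      where
      bound : ∀ i → n < a i → n ℕ.+ n ≤ a i → cofactorℕ 1≤m adm i ≡ γ → (m ℕ.+ m) ℕ.* b i ≤ (γ ℕ.+ γ') ℕ.* a i
      bound i n<a 2n≤a C≡ = begin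
        (m ℕ.+ m) ℕ.* b i                             ≡⟨ ℕP.*-distribʳ-+ (b i) m m ⟩
        m ℕ.* b i ℕ.+ m ℕ.* b i                       ≡⟨ cong₂ ℕ._+_ mb mb ⟩
        (a i ℕ.* γ ℕ.+ n) ℕ.+ (a i ℕ.* γ ℕ.+ n)       ≡⟨ ring₁ (a i) γ n ⟩
        (a i ℕ.* γ ℕ.+ a i ℕ.* γ) ℕ.+ (n ℕ.+ n)       ≤⟨ ℕP.+-monoʳ-≤ _ 2n≤a ⟩
        (a i ℕ.* γ ℕ.+ a i ℕ.* γ) ℕ.+ a i             ≡⟨ ring₂ (a i) γ ⟩
        (γ ℕ.+ suc γ) ℕ.* a i                         ≤⟨ ℕP.*-monoˡ-≤ (a i) (ℕP.+-monoʳ-≤ γ γ<γ') ⟩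
        (γ ℕ.+ γ') ℕ.* a i                            ∎
        where
        open ℕP.≤-Reasoning
        mb : m ℕ.* b i ≡ a i ℕ.* γ ℕ.+ n
        mb = trans (cofactorℕ-relation 1≤m adm i n<a) (cong (λ z → a i ℕ.* z ℕ.+ n) C≡)
        ring₁ : ∀ a γ n → (a ℕ.* γ ℕ.+ n) ℕ.+ (a ℕ.* γ ℕ.+ n) ≡ (a ℕ.* γ ℕ.+ a ℕ.* γ) ℕ.+ (n ℕ.+ n)
        ring₁ = ℕSolver.solve-∀
        ring₂ : ∀ a γ → (a ℕ.* γ ℕ.+ a ℕ.* γ) ℕ.+ a ≡ (γ ℕ.+ suc γ) ℕ.* a
        ring₂ = ℕSolver.solve-∀

    -- A rational p / q in the set satisfies a p γ ≤ p m b ≤ m q a, hence p / q does not exceed m /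
    -- γ.
    ¬BelowQ0 : ∀ {γ} → Alm U (λ i → cofactorℕ 1≤m adm i ≡ γ) → ¬ BelowQ0 a b U m γ
    ¬BelowQ0 {γ} C≡γ (p , q , _ , mq<pγ , pb≤qa) =
      proper U (map₃ U (λ i n<a C≡ h → ℕP.<⇒≱ mq<pγ (bound i n<a C≡ h)) (a-unbounded 1≤m adm (suc n)) C≡γ pb≤qa)
      where
      bound : ∀ i → n < a i → cofactorℕ 1≤m adm i ≡ γ → p ℕ.* b i ≤ q ℕ.* a i → p ℕ.* γ ≤ m ℕ.* q
      bound i n<a C≡ h = ℕP.*-cancelˡ-≤ (a i) {{ℕ.>-nonZero (ℕP.≤-trans (ℕ.s≤s ℕ.z≤n) n<a)}} (begin
        a i ℕ.* (p ℕ.* γ)                ≤⟨ ℕP.m≤m+n _ (p ℕ.* n) ⟩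
        a i ℕ.* (p ℕ.* γ) ℕ.+ p ℕ.* n    ≡⟨ ring₁ (a i) p γ n ⟩
        p ℕ.* (a i ℕ.* γ ℕ.+ n)          ≡⟨ cong (p ℕ.*_) mb ⟨
        p ℕ.* (m ℕ.* b i)                ≡⟨ ring₂ p m (b i) ⟩
        m ℕ.* (p ℕ.* b i)                ≤⟨ ℕP.*-monoʳ-≤ m h ⟩
        m ℕ.* (q ℕ.* a i)                ≡⟨ ring₃ m q (a i) ⟩
        a i ℕ.* (m ℕ.* q)                ∎)
        where
        open ℕP.≤-Reasoning
        mb : m ℕ.* b i ≡ a i ℕ.* γ ℕ.+ n
        mb = trans (cofactorℕ-relation 1≤m adm i n<a) (cong (λ z → a i ℕ.* z ℕ.+ n) C≡)
        ring₁ : ∀ a p γ n → a ℕ.* (p ℕ.* γ) ℕ.+ p ℕ.* n ≡ p ℕ.* (a ℕ.* γ ℕ.+ n)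
        ring₁ = ℕSolver.solve-∀
        ring₂ : ∀ p m b → p ℕ.* (m ℕ.* b) ≡ m ℕ.* (p ℕ.* b)
        ring₂ = ℕSolver.solve-∀
        ring₃ : ∀ m q a → m ℕ.* (q ℕ.* a) ≡ a ℕ.* (m ℕ.* q)
        ring₃ = ℕSolver.solve-∀

    remainder : ∃[ s ] s < m × Alm U (λ i → cofactorℕ 1≤m adm i ≡ m ℕ.* ⌊ b i / a i ⌋ ℕ.+ s) ×
                                 Alm U (λ i → Congruent m (+ s * + a i) (- (+ n)))
    remainder =
      let (s , s<m , eq) = bounded⇒constant U (λ i → cofactorℕ 1≤m adm i ℕ.∸ m ℕ.* ⌊ b i / a i ⌋) m
                             (map₁ U (λ i n<a → remainder-bound 1≤m n<a (cofactorℕ-relation 1≤m adm i n<a))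
                                     (a-unbounded 1≤m adm (suc n)))
      in s , s<m
       , map₂ U (λ i n<a e → trans (cofactor-split 1≤m n<a (cofactorℕ-relation 1≤m adm i n<a))
                                   (cong (m ℕ.* ⌊ b i / a i ⌋ ℕ.+_) e))
           (a-unbounded 1≤m adm (suc n)) eq
       , map₂ U (λ i n<a e → remainder-congruent 1≤m n<a (cofactorℕ-relation 1≤m adm i n<a) e)
           (a-unbounded 1≤m adm (suc n)) eq

CommonResidue-affine : ∀ U U' m s M (f f' c c' : ℕ → ℕ) →
  Alm U (λ i → f i ≡ m ℕ.* c i ℕ.+ s) → Alm U' (λ i → f' i ≡ m ℕ.* c' i ℕ.+ s) →
  CommonResidue U U' M (λ i → + c i) (λ i → + c' i) → CommonResidue U U' M (λ i → + f i) (λ i → + f' i)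
CommonResidue-affine U U' m s M f f' c c' eq eq' (r , p , p') =
  + m * r + + s , map₂ U (λ i → combine (f i) (c i)) eq p , map₂ U' (λ i → combine (f' i) (c' i)) eq' p'
  where
  combine : ∀ f c → f ≡ m ℕ.* c ℕ.+ s → Congruent M (+ c) r → Congruent M (+ f) (+ m * r + + s)
  combine _ c refl p = subst (λ z → Congruent M (z + + s) (+ m * r + + s)) (sym (ℤP.pos-* m c))
    (Congruent-+ M (+ m * + c) (+ m * r) (+ s) (+ s) (Congruent-* M (+ m) (+ c) r p) (Congruent-refl M (+ s)))

-- Agreement of the initial positions

module _ {m n : ℕ} (1≤m : 1 ≤ m) {a b U a' b' U'}
         (adm : Admissible m n a b U) (adm' : Admissible m n a' b' U')
         (sameD1 : SameD1 a U a' U') (sameQ0 : SameQ0 a b U a' b' U')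
         (sameD3 : Q0IsZero a b U → SameD3 a b U a' b' U') where

  a-residue : ∀ M → 1 ≤ M → CommonResidue U U' M (λ i → + a i) (λ i → + a' i)
  a-residue = commonResidue U U' a a' sameD1

  a-agree : ∀ Q → Agree U U' Q (a ∷ []) (a' ∷ [])
  a-agree Q = agree-unbounded U U' (a-unbounded 1≤m adm) (a-unbounded 1≤m adm') Q (a-residue (modulus Q) (1≤modulus Q))

  -- With α the common residue of a and a' modulo m, both remainders solve α s ≡ -n (mod m),
  -- and α is invertible modulo m.
  remainders-equal : proj₁ (remainder 1≤m adm) ≡ proj₁ (remainder 1≤m adm')
  remainders-equal =
    let (s  , s<m  , _ , sa≡-n)    = remainder 1≤m adm
        (s' , s'<m , _ , s'a'≡-n)  = remainder 1≤m adm'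
        (α , a≡α , a'≡α)           = a-residue m 1≤m
        s'α≡-n = Alm-dec U' (+ m ∣? (+ s' * α - - (+ n)))
                   (map₂ U' (λ i p q → Congruent-euclidean m (+ s' * + a' i) (+ s' * α) (- (+ n))
                                         (Congruent-* m (+ s') (+ a' i) α p) q) a'≡α s'a'≡-n)
    in Alm-dec U (s ℕ.≟ s') (map₃ U (λ i g p q → residue-unique s<m s'<m
         (∣ᵤ⇒∣ (ℤC.coprime-divisor (+ m) (+ a i) (+ s - + s') (ℕC.gcd≡1⇒coprime g)
           (∣⇒∣ᵤ (subst (+ m ∣_) (ring (+ s) (+ s') (+ a i) α (+ n))
             (∣m∣n⇒∣m+n q (∣n⇒∣m*n -1ℤ (∣m∣n⇒∣m+n s'α≡-n (Congruent-* m (+ s') (+ a i) α p)))))))))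
       (gcd[m,a]≡1 1≤m adm) a≡α sa≡-n)
    where
    ring : ∀ s s' a α n → (s * a - - n) + -1ℤ * ((s' * α - - n) + (s' * a - s' * α)) ≡ a * (s - s')
    ring = solve-∀

  C-residue : Q0IsZero a b U → ∀ M → 1 ≤ M →
              CommonResidue U U' M (λ i → + cofactorℕ 1≤m adm i) (λ i → + cofactorℕ 1≤m adm' i)
  C-residue q₀≡0 M 1≤M = CommonResidue-affine U U' m (proj₁ (remainder 1≤m adm)) M
    (cofactorℕ 1≤m adm) (cofactorℕ 1≤m adm') (λ i → ⌊ b i / a i ⌋) (λ i → ⌊ b' i / a' i ⌋)
    (proj₁ (proj₂ (proj₂ (remainder 1≤m adm))))
    (subst (λ s → Alm U' (λ i → cofactorℕ 1≤m adm' i ≡ m ℕ.* ⌊ b' i / a' i ⌋ ℕ.+ s)) (sym remainders-equal)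
      (proj₁ (proj₂ (proj₂ (remainder 1≤m adm')))))
    (commonResidue U U' (λ i → ⌊ b i / a i ⌋) (λ i → ⌊ b' i / a' i ⌋) (sameD3 q₀≡0) M 1≤M)

  -- Whether q₀ vanishes is decided only up to double negation, and so is the agreement. An infinite
  -- C is handled by its residues, a finite one by its standard value.
  C-agree : ∀ Q → ¬ ¬ Agree U U' Q (cofactorℕ 1≤m adm ∷ []) (cofactorℕ 1≤m adm' ∷ [])
  C-agree Q ¬ag with weakLEM U (BelowQ0 a b U 0 1)
  ... | inj₁ q₀≡0 = ¬ag (agree-unbounded U U' (C-unbounded 1≤m adm q₀≡0)
          (C-unbounded 1≤m adm' (λ p → q₀≡0 (from (sameQ0 0 1 ℕP.≤-refl) p))) Q
          (C-residue q₀≡0 (modulus Q) (1≤modulus Q)))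
  ... | inj₂ q₀≢0 = q₀≢0 λ p →
    let (γ , C≡γ)    = C-bounded 1≤m adm p
        (γ' , C'≡γ') = C-bounded 1≤m adm' (to (sameQ0 0 1 ℕP.≤-refl) p)
        -- If γ' < γ, then m / γ lies below the supremum of the second pair but not below that of
        -- the first; the other case is symmetric.
        γ≡γ' = ℕP.≤-antisym
          (ℕP.≮⇒≥ λ γ'<γ → ¬BelowQ0 1≤m adm C≡γ
             (from (sameQ0 m γ (ℕP.≤-trans (ℕ.s≤s ℕ.z≤n) γ'<γ)) (BelowQ0-intro 1≤m adm' C'≡γ' γ'<γ)))
          (ℕP.≮⇒≥ λ γ<γ' → ¬BelowQ0 1≤m adm' C'≡γ'
             (to (sameQ0 m γ' (ℕP.≤-trans (ℕ.s≤s ℕ.z≤n) γ<γ')) (BelowQ0-intro 1≤m adm C≡γ γ<γ')))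
    in ¬ag (agree-constant U U' γ C≡γ (subst (λ z → Alm U' (λ i → cofactorℕ 1≤m adm' i ≡ z)) (sym γ≡γ') C'≡γ') Q)

theorem5p2 : (m n : ℕ) → 1 ≤ m → 1 ≤ n →
    (a b : ℕ → ℕ) (U : Ultrafilter) → Admissible m n a b U →
    (a' b' : ℕ → ℕ) (U' : Ultrafilter) → Admissible m n a' b' U' →
    SameD1 a U a' U' →
    SameQ0 a b U a' b' U' →
    (Q0IsZero a b U → SameD3 a b U a' b' U') →
    ElementarilyEquivalent (Ultraproduct a b U) (Ultraproduct a' b' U')
theorem5p2 m n 1≤m _ a b U adm a' b' U' adm' sameD1 sameQ0 sameD3 φ =
  let (Q₁ , Q₂ , tr) = Transfer.transfer m n 1≤m φ
      𝓜  = model 1≤m adm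
      𝓜' = model 1≤m adm'
      ag₁ = a-agree 1≤m adm adm' sameD1 sameQ0 sameD3 Q₁
      ag₂ = C-agree 1≤m adm adm' sameD1 sameQ0 sameD3 Q₂
  -- Agreement for C is doubly negated, so it can be used only towards a contradiction; stability of
  -- satisfaction reduces each direction to one.
  in mk⇔ (λ sat → Sat-stable (Ultraproduct a' b' U') [] φ λ ¬sat → ag₂ λ ag₂ →
            ¬sat (tr 𝓜 𝓜' [] [] ag₁ ag₂ sat))
         (λ sat → Sat-stable (Ultraproduct a b U) [] φ λ ¬sat → ag₂ λ ag₂ →
            ¬sat (tr 𝓜' 𝓜 [] [] (Agree-sym {U} {U'} ag₁) (Agree-sym {U} {U'} ag₂) sat))
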